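{- For every integer $n\geq 1$, $$A_{n}(t)=\frac{(1+t^{2})^{n}}{2(1+t)^{n-1}}P_{n}^{\mathrm{udr}}\left(\frac{2t}{1+t^{2}}\right).$$ Equivalently, $$P_{n}^{\mathrm{udr}}(t)=\frac{2(1+v)^{n-1}}{(1+v^{2})^{n}}A_{n}(v),\qquad\text{where } v=\frac{1-\sqrt{1-t^{2}}}{t}.$$
   Context: $\mathfrak{S}_n$ is the set of permutations $\pi=\pi_1\cdots\pi_n$ of $[n]=\{1,\dots,n\}$. For $\pi\in\mathfrak{S}_n$, $\mathrm{des}(\pi)$ is the number of $i\in[n-1]$ with $\pi_i>\pi_{i+1}$, and $A_n(t)=\sum_{\pi\in\mathfrak{S}_n}t^{\mathrm{des}(\pi)+1}$ ($n\ge1$). An increasing run of $\pi$ is a maximal increasing consecutive subsequence. A birun of $\pi$ is a maximal monotone (increasing or decreasing) consecutive subsequence of length at least two. An up-down run of $\pi$ is either a birun of $\pi$, or the letter $\pi_1$ if it is an increasing run of length $1$. $\mathrm{udr}(\pi)$ is the number of up-down runs of $\pi$ (e.g. $\mathrm{udr}(85712643)=6$, the up-down runs being $8,85,57,71,126,643$). $P_n^{\mathrm{udr}}(t)=\sum_{\pi\in\mathfrak{S}_n}t^{\mathrm{udr}(\pi)}$. In the second identity, $\sqrt{1-t^2}$ is the formal power series in $t$ with constant term $1$, so that $v$ is a formal power series in $t$. -}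

module Defs where

open import Algebra.Bundles using (RawSemiring)
open import Data.Fin.Base using (Fin; toℕ; fromℕ; inject₁)
open import Data.Fin.Properties using (toℕ<n; toℕ-inject₁; toℕ-fromℕ)
open import Data.List.Base using (List; []; _∷_; length; map; foldr; filter; take; drop; zip; upTo; cartesianProduct; cartesianProductWith)
open import Data.List.Relation.Unary.All using (All; all?)
open import Data.List.Relation.Unary.Linked using (Linked; linked?)
open import Data.List.Relation.Unary.Unique.DecPropositional using (unique?)
open import Data.Nat.Base as ℕ using (ℕ; zero; suc; _∸_; _<_; _>_; s≤s)
open import Data.Nat.Induction using (<-rec; <-Rec; <-wellFounded)
import Data.Nat.Properties as ℕ
open import Data.Product.Base using (_×_; _,_)
open import Data.Product.Properties using (≡-dec)
open import Data.Rational.Base as ℚ using (ℚ; 0ℚ; 1ℚ; ½; NonZero; 1/_)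
import Data.Rational.Properties as ℚ
open import Data.Rational.Solver using () renaming (module +-*-Solver to ℚ-Solver)
open import Data.Sum.Base using (_⊎_)
open import Induction.WellFounded using (module FixPoint)
open import Level using (0ℓ)
open import Relation.Binary.PropositionalEquality using (_≡_; _≢_; refl; sym; trans; cong; cong₂; module ≡-Reasoning)
open import Relation.Nullary.Decidable using (Dec; _×-dec_; _⊎-dec_; _→-dec_)
open import Relation.Unary using (Pred; Decidable)

open import Algebra.Properties.CommutativeMonoid.Sum ℚ.+-0-commutativeMonoid using (sum-syntax; sum⁺-syntax; sum-cong-≗; sum-init-last; sum-replicate-zero)

Word : Set
Word = List ℕ

[1⋯_] : ℕ → List ℕ
[1⋯ n ] = map suc (upTo n)

-- 𝔖 n lists, each once, the words of length n over [n] with distinct letters.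

words : ℕ → List ℕ → List Word
words zero    alphabet = [] ∷ []
words (suc k) alphabet = cartesianProductWith _∷_ alphabet (words k alphabet)

𝔖 : ℕ → List Word
𝔖 n = filter (unique? ℕ._≟_) (words n [1⋯ n ])

des : Word → ℕ
des π = length (filter (λ (a , b) → b ℕ.<? a) (zip π (drop 1 π)))

-- (i , j) with i < j ≤ length w stands for the nonempty consecutive
-- subsequence of w in the (0-based) positions i, …, j ∸ 1.

Interval : Set
Interval = ℕ × ℕ

intervals : Word → List Interval
intervals w = filter (λ (i , j) → i ℕ.<? j) (cartesianProduct positions positions)
  where positions = upTo (suc (length w))

segment : Word → Interval → Word
segment w (i , j) = take (j ∸ i) (drop i w)

_⊆_ : Interval → Interval → Set
(i , j) ⊆ (i′ , j′) = i′ ℕ.≤ i × j ℕ.≤ j′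

_⊆?_ : ∀ I J → Dec (I ⊆ J)
(i , j) ⊆? (i′ , j′) = (i′ ℕ.≤? i) ×-dec (j ℕ.≤? j′)

_≟ᴵ_ : (I J : Interval) → Dec (I ≡ J)
_≟ᴵ_ = ≡-dec ℕ._≟_ ℕ._≟_

Maximal : Pred Word 0ℓ → Word → Pred Interval 0ℓ
Maximal Q w I = Q (segment w I) × All (λ J → I ⊆ J → Q (segment w J) → J ≡ I) (intervals w)

maximal? : ∀ {Q} → Decidable Q → ∀ w → Decidable (Maximal Q w)
maximal? Q? w I = Q? (segment w I) ×-dec
  all? (λ J → (I ⊆? J) →-dec (Q? (segment w J) →-dec (J ≟ᴵ I))) (intervals w)

Increasing Decreasing Monotone : Pred Word 0ℓ
Increasing   = Linked _<_
Decreasing   = Linked _>_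
Monotone   s = Increasing s ⊎ Decreasing s

increasing? : Decidable Increasing
increasing? = linked? ℕ._<?_

monotone? : Decidable Monotone
monotone? s = increasing? s ⊎-dec linked? ℕ._>?_ s

IncreasingRun Birun UpDownRun : Word → Pred Interval 0ℓ
IncreasingRun π I = Maximal Increasing π I
Birun         π I = 2 ℕ.≤ length (segment π I) × Maximal Monotone π I
UpDownRun     π I = Birun π I ⊎ (I ≡ (0 , 1) × IncreasingRun π I)

upDownRun? : ∀ π → Decidable (UpDownRun π)
upDownRun? π I =
  ((2 ℕ.≤? length (segment π I)) ×-dec maximal? monotone? π I)
  ⊎-dec ((I ≟ᴵ (0 , 1)) ×-dec maximal? increasing? π I)

udr : Word → ℕ
udr π = length (filter (upDownRun? π) (intervals π))

-- ℚ[[t]], with f k the coefficient of tᵏ.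

FPS : Set
FPS = ℕ → ℚ

infix  4 _≈_
infixl 6 _+_ _-_
infixl 7 _*_ _/_[_]
infix  9 _/t

_≈_ : FPS → FPS → Set
f ≈ g = ∀ k → f k ≡ g k

const : ℚ → FPS
const c zero    = c
const c (suc k) = 0ℚ

t : FPS
t zero          = 0ℚ
t (suc zero)    = 1ℚ
t (suc (suc k)) = 0ℚ

_+_ _-_ _*_ : FPS → FPS → FPS
(f + g) k = f k ℚ.+ g k
(f - g) k = f k ℚ.- g k
(f * g) k = ∑[ i ≤ k ] (f (toℕ i) ℚ.* g (k ∸ toℕ i))

0# 1# 2# : FPS
0# = const 0ℚ
1# = const 1ℚ
2# = const (1ℚ ℚ.+ 1ℚ)

fpsRawSemiring : RawSemiring 0ℓ 0ℓ
fpsRawSemiring = record { _≈_ = _≈_ ; _+_ = _+_ ; _*_ = _*_ ; 0# = 0# ; 1# = 1# }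

open import Algebra.Definitions.RawSemiring fpsRawSemiring public using (_^_)

∑-list : {A : Set} → List A → (A → FPS) → FPS
∑-list xs f = foldr _+_ 0# (map f xs)

syntax ∑-list xs (λ x → e) = ∑[ x ∈ xs ] e

-- A rational function whose denominator has nonzero constant term is
-- identified with its expansion in ℚ[[t]]; this embedding is injective.

record Invertible (f : FPS) : Set where
  constructor invertible
  field f₀≢0 : f 0 ≢ 0ℚ

-- The coefficients gₖ of 1/f are determined by f₀ g₀ = 1 and
-- f₀ gₖ₊₁ + ∑_{i ≤ k} fᵢ₊₁ gₖ₋ᵢ = 0.

recip-step : (f : FPS) → .{{NonZero (f 0)}} → ∀ k → <-Rec (λ _ → ℚ) k → ℚ
recip-step f zero    g = 1/ f 0
recip-step f (suc k) g =
  ℚ.- (1/ f 0 ℚ.* (∑[ i ≤ k ] (f (suc (toℕ i)) ℚ.* g (s≤s (ℕ.m∸n≤m k (toℕ i))))))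

recip : (f : FPS) → .(Invertible f) → FPS
recip f f⁻¹ = <-rec (λ _ → ℚ) (recip-step f {{ℚ.≢-nonZero (Invertible.f₀≢0 f⁻¹)}})

_/_[_] : (f g : FPS) → .(Invertible g) → FPS
f / g [ g⁻¹ ] = f * recip g g⁻¹

recip-unfold : ∀ f f⁻¹ k → let instance _ = ℚ.≢-nonZero (Invertible.f₀≢0 f⁻¹) in
               recip f f⁻¹ k ≡ recip-step f k (λ {j} _ → recip f f⁻¹ j)
recip-unfold f f⁻¹ k = FixPoint.unfold-wfRec <-wellFounded (λ _ → ℚ) (recip-step f)
  (λ { zero    eq → refl
     ; (suc k) eq → cong (λ s → ℚ.- (1/ f 0 ℚ.* s))
                      (sum-cong-≗ {suc k} λ i → cong (f (suc (toℕ i)) ℚ.*_) (eq (s≤s (ℕ.m∸n≤m k (toℕ i))))) })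
  {k}
  where instance _ = ℚ.≢-nonZero (Invertible.f₀≢0 f⁻¹)

*-recip : ∀ f f⁻¹ → f * recip f f⁻¹ ≈ 1#
*-recip f f⁻¹ zero    = begin
  f 0 ℚ.* g 0 ℚ.+ 0ℚ       ≡⟨ ℚ.+-identityʳ _ ⟩
  f 0 ℚ.* g 0              ≡⟨ cong (f 0 ℚ.*_) (recip-unfold f f⁻¹ 0) ⟩
  f 0 ℚ.* 1/ f 0           ≡⟨ ℚ.*-inverseʳ (f 0) ⟩
  1ℚ                       ∎
  where
  open ≡-Reasoning
  instance _ = ℚ.≢-nonZero (Invertible.f₀≢0 f⁻¹)
  g = recip f f⁻¹
*-recip f f⁻¹ (suc k) = begin
  f 0 ℚ.* g (suc k) ℚ.+ S                ≡⟨ cong (λ x → f 0 ℚ.* x ℚ.+ S) (recip-unfold f f⁻¹ (suc k)) ⟩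
  f 0 ℚ.* (ℚ.- (1/ f 0 ℚ.* S)) ℚ.+ S     ≡⟨ cong (ℚ._+ S) (ℚ.neg-distribʳ-* (f 0) (1/ f 0 ℚ.* S)) ⟨
  ℚ.- (f 0 ℚ.* (1/ f 0 ℚ.* S)) ℚ.+ S     ≡⟨ cong (λ x → ℚ.- x ℚ.+ S) (ℚ.*-assoc (f 0) (1/ f 0) S) ⟨
  ℚ.- (f 0 ℚ.* 1/ f 0 ℚ.* S) ℚ.+ S       ≡⟨ cong (λ x → ℚ.- (x ℚ.* S) ℚ.+ S) (ℚ.*-inverseʳ (f 0)) ⟩
  ℚ.- (1ℚ ℚ.* S) ℚ.+ S                   ≡⟨ cong (λ x → ℚ.- x ℚ.+ S) (ℚ.*-identityˡ S) ⟩
  ℚ.- S ℚ.+ S                            ≡⟨ ℚ.+-inverseˡ S ⟩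
  0ℚ                                     ∎
  where
  open ≡-Reasoning
  instance _ = ℚ.≢-nonZero (Invertible.f₀≢0 f⁻¹)
  g = recip f f⁻¹
  S = ∑[ i ≤ k ] (f (suc (toℕ i)) ℚ.* g (k ∸ toℕ i))

-- For f with zero constant term, f /t is the series with t * f /t ≈ f.

_/t : FPS → FPS
(f /t) k = f (suc k)

t*[f/t] : ∀ f → f 0 ≡ 0ℚ → t * f /t ≈ f
t*[f/t] f f₀≡0 zero    = trans (ℚ.+-identityʳ (0ℚ ℚ.* f 1)) (trans (ℚ.*-zeroˡ (f 1)) (sym f₀≡0))
t*[f/t] f f₀≡0 (suc k) = begin
  0ℚ ℚ.* f (suc (suc k)) ℚ.+ (1ℚ ℚ.* f (suc k) ℚ.+ ∑[ i < k ] (0ℚ ℚ.* g i))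
    ≡⟨ cong (λ s → 0ℚ ℚ.* f (suc (suc k)) ℚ.+ (1ℚ ℚ.* f (suc k) ℚ.+ s)) zeros ⟩
  0ℚ ℚ.* f (suc (suc k)) ℚ.+ (1ℚ ℚ.* f (suc k) ℚ.+ 0ℚ)
    ≡⟨ solve 2 (λ x y → con 0ℚ :* x :+ (con 1ℚ :* y :+ con 0ℚ) := y) refl (f (suc (suc k))) (f (suc k)) ⟩
  f (suc k) ∎
  where
  open ≡-Reasoning
  open ℚ-Solver
  g : Fin k → ℚ
  g i = f (suc (k ∸ suc (toℕ i)))
  zeros : ∑[ i < k ] (0ℚ ℚ.* g i) ≡ 0ℚ
  zeros = trans (sum-cong-≗ {k} λ i → ℚ.*-zeroˡ (g i)) (sum-replicate-zero k)

-- For f with constant term 1, √ f is the square root of f with constant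
-- term 1; its coefficients rₖ are determined by
-- 2 rₖ₊₁ + ∑_{i < k} rᵢ₊₁ rₖ₋ᵢ = fₖ₊₁.

√-step : (f : FPS) → ∀ k → <-Rec (λ _ → ℚ) k → ℚ
√-step f zero    r = 1ℚ
√-step f (suc k) r =
  ½ ℚ.* (f (suc k) ℚ.- ∑[ i < k ] (r (s≤s (toℕ<n i)) ℚ.* r (s≤s (ℕ.m∸n≤m k (toℕ i)))))

√_ : FPS → FPS
√ f = <-rec (λ _ → ℚ) (√-step f)

√-unfold : ∀ f k → (√ f) k ≡ √-step f k (λ {j} _ → (√ f) j)
√-unfold f k = FixPoint.unfold-wfRec <-wellFounded (λ _ → ℚ) (√-step f)
  (λ { zero    eq → refl
     ; (suc k) eq → cong (λ s → ½ ℚ.* (f (suc k) ℚ.- s))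
                      (sum-cong-≗ {k} λ i → cong₂ ℚ._*_ (eq (s≤s (toℕ<n i))) (eq (s≤s (ℕ.m∸n≤m k (toℕ i))))) })
  {k}

√-square : ∀ f → f 0 ≡ 1ℚ → √ f * √ f ≈ f
√-square f f₀≡1 zero    = sym f₀≡1
√-square f f₀≡1 (suc k) = begin
  1ℚ ℚ.* R ℚ.+ ∑[ i ≤ k ] T i                ≡⟨ cong (1ℚ ℚ.* R ℚ.+_) (sum-init-last T) ⟩
  1ℚ ℚ.* R ℚ.+ (∑[ i < k ] T (inject₁ i) ℚ.+ T (fromℕ k))
                                             ≡⟨ cong₂ (λ x y → 1ℚ ℚ.* R ℚ.+ (x ℚ.+ y)) init≡ last≡ ⟩
  1ℚ ℚ.* R ℚ.+ (S ℚ.+ R ℚ.* 1ℚ)              ≡⟨ solve 2 (λ R S → con 1ℚ :* R :+ (S :+ R :* con 1ℚ) := S :+ con (1ℚ ℚ.+ 1ℚ) :* R) refl R S ⟩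
  S ℚ.+ (1ℚ ℚ.+ 1ℚ) ℚ.* R                    ≡⟨ cong (λ x → S ℚ.+ (1ℚ ℚ.+ 1ℚ) ℚ.* x) (√-unfold f (suc k)) ⟩
  S ℚ.+ (1ℚ ℚ.+ 1ℚ) ℚ.* (½ ℚ.* (f (suc k) ℚ.- S))
                                             ≡⟨ solve 2 (λ F S → S :+ con (1ℚ ℚ.+ 1ℚ) :* (con ½ :* (F :- S)) := F) refl (f (suc k)) S ⟩
  f (suc k)                                  ∎
  where
  open ≡-Reasoning
  open ℚ-Solver
  R = (√ f) (suc k)
  T : Fin (suc k) → ℚ
  T i = (√ f) (suc (toℕ i)) ℚ.* (√ f) (k ∸ toℕ i)
  S = ∑[ i < k ] ((√ f) (suc (toℕ i)) ℚ.* (√ f) (k ∸ toℕ i))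
  init≡ : ∑[ i < k ] T (inject₁ i) ≡ S
  init≡ = sum-cong-≗ {k} λ i → cong (λ j → (√ f) (suc j) ℚ.* (√ f) (k ∸ j)) (toℕ-inject₁ i)
  last≡ : T (fromℕ k) ≡ R ℚ.* 1ℚ
  last≡ = cong₂ (λ j l → (√ f) (suc j) ℚ.* (√ f) l) (toℕ-fromℕ k)
            (trans (cong (k ∸_) (toℕ-fromℕ k)) (ℕ.n∸n≡0 k))

v : FPS
v = (1# - √ (1# - t ^ 2)) /t

*-≢0 : ∀ {p q} → p ≢ 0ℚ → q ≢ 0ℚ → p ℚ.* q ≢ 0ℚ
*-≢0 {p} {q} p≢0 q≢0 pq≡0 = q≢0 (begin
  q                        ≡⟨ ℚ.*-identityˡ q ⟨
  1ℚ ℚ.* q                 ≡⟨ cong (ℚ._* q) (ℚ.*-inverseˡ p) ⟨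
  1/ p ℚ.* p ℚ.* q         ≡⟨ ℚ.*-assoc (1/ p) p q ⟩
  1/ p ℚ.* (p ℚ.* q)       ≡⟨ cong (1/ p ℚ.*_) pq≡0 ⟩
  1/ p ℚ.* 0ℚ              ≡⟨ ℚ.*-zeroʳ (1/ p) ⟩
  0ℚ                       ∎)
  where
  open ≡-Reasoning
  instance _ = ℚ.≢-nonZero p≢0

*-invertible : ∀ {f g} → Invertible f → Invertible g → Invertible (f * g)
*-invertible {f} {g} (invertible f₀≢0) (invertible g₀≢0) = invertible
  λ f₀g₀+0≡0 → *-≢0 f₀≢0 g₀≢0 (trans (sym (ℚ.+-identityʳ (f 0 ℚ.* g 0))) f₀g₀+0≡0)

^-invertible : ∀ {f} n → Invertible f → Invertible (f ^ n)
^-invertible zero    f⁻¹ = invertible λ ()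
^-invertible (suc n) f⁻¹ = *-invertible f⁻¹ (^-invertible n f⁻¹)

[1+t²]-invertible : Invertible (1# + t ^ 2)
[1+t²]-invertible = invertible λ ()

2[1+t]^-invertible : ∀ n → Invertible (2# * (1# + t) ^ n)
2[1+t]^-invertible n = *-invertible {2#} (invertible λ ()) (^-invertible n (invertible λ ()))

[1+v²]^-invertible : ∀ n → Invertible ((1# + v ^ 2) ^ n)
[1+v²]^-invertible n = ^-invertible n (invertible λ ())

-- The polynomials A_n and P_n^udr, with a power series x substituted for
-- the variable; x = t gives the polynomials themselves.

A : ℕ → FPS → FPS
A n x = ∑[ π ∈ 𝔖 n ] (x ^ suc (des π))

Pᵘᵈʳ : ℕ → FPS → FPS
Pᵘᵈʳ n x = ∑[ π ∈ 𝔖 n ] (x ^ udr π)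

{-# OPTIONS --safe #-}

-- Inserting n + 1 into the permutations of [n] gives recurrences for A_n and
-- P_n in which the exponent of each monomial occurs as a factor, i.e. which
-- involve x·d/dx. Let δ be a derivation with δ x = x, and let z (1 + x²) = 2x;
-- then (1 + x²) δ z = (1 - x²) z, and both 2 (1 + x)ⁿ⁻¹ A_n(x) and
-- (1 + x²)ⁿ P_n(z) satisfy
--   Xₙ₊₁ = (1 - x²) δ Xₙ + (2x + 2n x²) Xₙ,   X₁ = 2x,
-- so they agree. The first identity is the case x = t, δ = t·d/dt; the second
-- is the case x = v, z = t, δ = √(1 - t²) t·d/dt.

module Submission where

open import Algebra.Bundles using (CommutativeRing)
import Algebra.Solver.Ring
open import Algebra.Solver.Ring.AlmostCommutativeRing using (fromCommutativeRing; _-Raw-AlmostCommutative⟶_)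
import Data.Fin.Base as Fin
open import Data.List.Base using (List; []; _∷_; _++_; length; map; foldr; concatMap; filter; take; drop; upTo; zip)
open import Data.List.Membership.Propositional using (_∈_; _∉_; find; lose)
import Data.List.Relation.Binary.Permutation.Propositional as ↭
open ↭ using (_↭_)
open import Data.List.Relation.Unary.All as All using (All; []; _∷_)
open import Data.List.Relation.Unary.Any using (here; there)
open import Data.Maybe.Base as Maybe using ()
open import Data.Nat as ℕ using (ℕ; zero; suc; _∸_; _<_; _>_; _≤_; _≥_; s≤s; z≤n)
import Data.Nat.Properties as ℕ
open import Data.Product using (_×_; _,_; ∃; proj₁; proj₂)
open import Data.Rational.Base as ℚ using (ℚ; 0ℚ; 1ℚ; ½)
import Data.Rational.Properties as ℚ
open import Data.Rational.Solver using () renaming (module +-*-Solver to ℚ-Solver)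
open import Defs hiding (A; t; v; _≈_; _+_; _-_; _*_; _^_; 0#; 1#; 2#)
open import Function.Base using (_∘_)
open import Level using (0ℓ)
open import Relation.Binary.Consequences using (dec⇒weaklyDec)
open import Relation.Binary.PropositionalEquality as ≡ using (_≡_)
import Relation.Binary.Reasoning.Setoid
open import Relation.Binary.Structures using (IsEquivalence)
open import Relation.Nullary using (¬_; yes; no; contradiction; ¬?; Dec; _×-dec_; _⊎-dec_)

-- The coefficients of the recurrences come from counting the n + 1 insertions into a single
-- permutation of [n]. With d descents, the d + 1 places at the end and inside a descent keep d, and
-- the others add one. With k up-down runs, k places keep k, one adds one and the remaining n - k
-- add two. The obstacle on the second side is that `udr` counts maximal intervals, which do not
-- follow a recursion along the word. Up-down runs are therefore identified by their right ends, and
-- these are the turns of the word with 0 put in front, together with its last position. The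
-- relation `z (1 + x²) = 2x` matters because `(1 - z²) (1 + x²)² = (1 - x²)²`: the coefficient of
-- the derivative in the recurrence for P_n becomes a square, one factor of which is consumed by
-- `(1 + x²) δ z = (1 - x²) z`. Series are never composed, and neither identity is deduced from the
-- other: x and z are arbitrary elements of a commutative ring over ℚ, and every denominator is
-- cleared until the very end.

module Words where

  open import Data.List.Membership.DecPropositional ℕ._≟_ using (_∈?_)
  open import Data.List.Membership.Propositional.Properties
  open import Data.List.Membership.Propositional.Properties.WithK using (unique∧set⇒bag)
  open import Data.List.Properties using (filter-accept; filter-reject; filter-all; length-map; length-take;
    length-drop; ∷-injectiveʳ)
  open import Data.List.Relation.Binary.BagAndSetEquality using (∼bag⇒↭)
  open import Data.List.Relation.Binary.Permutation.Propositional using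
    (↭-refl; ↭-trans; ↭-sym; prep; swap; ↭⇒↭ₛ)
  open import Data.List.Relation.Binary.Permutation.Propositional.Properties using (↭-length; All-resp-↭)
  import Data.List.Relation.Unary.All.Properties as All
  open import Data.List.Relation.Unary.AllPairs using ([]; _∷_)
  open import Data.List.Relation.Unary.Linked using (Linked; []; [-]; _∷_)
  open import Data.List.Relation.Unary.Linked.Properties using (AllPairs⇒Linked)
  open import Data.List.Relation.Unary.Unique.DecPropositional ℕ._≟_ using (unique?)
  open import Data.List.Relation.Unary.Unique.Propositional using (Unique)
  import Data.List.Relation.Unary.Unique.Propositional.Properties as Unique
  open import Data.Sum as Sum using (_⊎_; inj₁; inj₂)
  open import Function.Bundles using (mk⇔)
  open import Relation.Binary.Core using (Rel)
  import Relation.Binary.Definitions as B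
  open B using (tri<; tri≈; tri>)
  open ≡ using (_≢_; refl; sym; trans; cong; subst; subst₂; ≢-sym; setoid; module ≡-Reasoning)
  open import Data.List.Relation.Binary.Permutation.Setoid.Properties (setoid ℕ) using (Unique-resp-↭)

  private variable
    R : Rel ℕ 0ℓ
    i j k m n : ℕ
    w π σ : Word

  des-descent : ∀ {a b} w → b < a → des (a ∷ b ∷ w) ≡ suc (des (b ∷ w))
  des-descent w b<a = cong length
    (filter-accept {P = λ (a , b) → b < a} (λ (a , b) → b ℕ.<? a) {x = _ , _} {xs = zip (_ ∷ w) w} b<a)

  des-ascent : ∀ {a b} w → ¬ b < a → des (a ∷ b ∷ w) ≡ des (b ∷ w)
  des-ascent w b≮a = cong length
    (filter-reject {P = λ (a , b) → b < a} (λ (a , b) → b ℕ.<? a) {x = _ , _} {xs = zip (_ ∷ w) w} b≮a)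

  -- Permutations by insertion of the largest letter

  insertions : ℕ → Word → List Word
  insertions m []      = (m ∷ []) ∷ []
  insertions m (a ∷ w) = (m ∷ a ∷ w) ∷ map (a ∷_) (insertions m w)

  delete : ℕ → Word → Word
  delete m = filter (λ a → ¬? (a ℕ.≟ m))

  ∷-∈-insertions : ∀ m π → m ∷ π ∈ insertions m π
  ∷-∈-insertions m []      = here refl
  ∷-∈-insertions m (a ∷ π) = here refl

  ∈-insertions⇒↭ : ∀ π → σ ∈ insertions m π → σ ↭ m ∷ π
  ∈-insertions⇒↭ []      (here refl) = ↭-refl
  ∈-insertions⇒↭ (a ∷ π) (here refl) = ↭-refl
  ∈-insertions⇒↭ {m = m} (a ∷ π) (there σ∈) with _ , σ′∈ , refl ← ∈-map⁻ (a ∷_) σ∈ =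
    ↭-trans (prep a (∈-insertions⇒↭ π σ′∈)) (swap a m ↭-refl)

  delete-≡ : ∀ m π → delete m (m ∷ π) ≡ delete m π
  delete-≡ m π = filter-reject (λ a → ¬? (a ℕ.≟ m)) (λ m≢m → m≢m refl)

  delete-≢ : ∀ {a} π → a ≢ m → delete m (a ∷ π) ≡ a ∷ delete m π
  delete-≢ {m} π = filter-accept (λ a → ¬? (a ℕ.≟ m))

  delete-absent : All (_≢ m) π → delete m π ≡ π
  delete-absent {m} = filter-all (λ a → ¬? (a ℕ.≟ m))

  delete-insertion : ∀ π → All (_≢ m) π → σ ∈ insertions m π → delete m σ ≡ π
  delete-insertion {m} []      []          (here refl) = delete-≡ m []
  delete-insertion {m} (a ∷ π) a∷π≢m       (here refl) = trans (delete-≡ m (a ∷ π)) (delete-absent a∷π≢m)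
  delete-insertion {m} (a ∷ π) (a≢m ∷ π≢m) (there σ∈) with σ′ , σ′∈ , refl ← ∈-map⁻ (a ∷_) σ∈ =
    trans (delete-≢ σ′ a≢m) (cong (a ∷_) (delete-insertion π π≢m σ′∈))

  insertion-delete : ∀ σ → Unique σ → m ∈ σ → σ ∈ insertions m (delete m σ)
  insertion-delete (m ∷ σ) (m∉σ ∷ σ!) (here refl) = subst (λ π → m ∷ σ ∈ insertions m π)
    (sym (trans (delete-≡ m σ) (delete-absent (All.map ≢-sym m∉σ)))) (∷-∈-insertions m σ)
  insertion-delete {m} (a ∷ σ) (a∉σ ∷ σ!) (there m∈σ) = subst (λ π → a ∷ σ ∈ insertions m π)
    (sym (delete-≢ σ (All.lookup a∉σ m∈σ))) (there (∈-map⁺ (a ∷_) (insertion-delete σ σ! m∈σ)))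

  insertions-unique : ∀ π → All (_≢ m) π → Unique (insertions m π)
  insertions-unique []      []          = [] ∷ []
  insertions-unique (a ∷ π) (a≢m ∷ π≢m) =
    All.map⁺ (All.tabulate λ { _ refl → a≢m refl }) ∷ Unique.map⁺ ∷-injectiveʳ (insertions-unique π π≢m)

  -- The map `r` recovers from an element the block that it lies in, so distinct blocks are
  -- disjoint.
  concatMap-unique : ∀ {X Y : Set} {f : X → List Y} (r : Y → X) xs → Unique xs → (∀ {x} → x ∈ xs → Unique (f x)) →
                     (∀ {x y} → x ∈ xs → y ∈ f x → r y ≡ x) → Unique (concatMap f xs)
  concatMap-unique r []       []          f! rf = []
  concatMap-unique {f = f} r (x ∷ xs) (x∉xs ∷ xs!) f! rf = Unique.++⁺ (f! (here refl))
    (concatMap-unique r xs xs! (f! ∘ there) (rf ∘ there))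
    λ (y∈fx , y∈rest) → let x′ , x′∈xs , y∈fx′ = find (∈-concatMap⁻ f y∈rest) in
      All.lookup x∉xs x′∈xs (trans (sym (rf (here refl) y∈fx)) (rf (there x′∈xs) y∈fx′))

  -- Membership in `𝔖 n` as conditions on the word alone, so that insertion and deletion can be
  -- studied without the enumeration.
  record Arrangement (n : ℕ) (π : Word) : Set where
    constructor arrangement
    field
      length≡n : length π ≡ n
      positive : All (0 <_) π
      bounded  : All (_≤ n) π
      distinct : Unique π

  words⁻ : ∀ k {alphabet w} → w ∈ words k alphabet → length w ≡ k × All (_∈ alphabet) w
  words⁻ zero    (here refl) = refl , []
  words⁻ (suc k) {alphabet} w∈
    with _ , _ , a∈ , w′∈ , refl ← ∈-cartesianProductWith⁻ _∷_ alphabet (words k alphabet) w∈ =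
    let length≡ , all∈ = words⁻ k w′∈ in cong suc length≡ , a∈ ∷ all∈

  words⁺ : ∀ {alphabet w} → All (_∈ alphabet) w → w ∈ words (length w) alphabet
  words⁺ []          = here refl
  words⁺ (a∈ ∷ all∈) = ∈-cartesianProductWith⁺ _∷_ a∈ (words⁺ all∈)

  words-unique : ∀ k {alphabet} → Unique alphabet → Unique (words k alphabet)
  words-unique zero    alphabet! = [] ∷ []
  words-unique (suc k) alphabet! =
    Unique.cartesianProductWith⁺ _∷_ (λ { refl → refl , refl }) alphabet! (words-unique k alphabet!)

  𝔖⁻ : ∀ n → π ∈ 𝔖 n → Arrangement n π
  𝔖⁻ n π∈
    with w∈ , π! ← ∈-filter⁻ unique? {xs = words n [1⋯ n ]} π∈
    with length≡n , letters ← words⁻ n w∈ = record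
    { length≡n = length≡n
    ; positive = All.map (λ a∈ → let _ , _ , a≡ = ∈-map⁻ suc a∈ in subst (0 <_) (sym a≡) (s≤s z≤n)) letters
    ; bounded  = All.map (λ a∈ → let _ , b∈ , a≡ = ∈-map⁻ suc a∈ in subst (_≤ n) (sym a≡) (∈-upTo⁻ b∈)) letters
    ; distinct = π!
    }

  𝔖⁺ : Arrangement n π → π ∈ 𝔖 n
  𝔖⁺ {π = π} (arrangement refl positive bounded distinct) =
    ∈-filter⁺ unique?
      (words⁺ (All.zipWith (λ { (s≤s _ , a≤n) → ∈-map⁺ suc (∈-upTo⁺ a≤n) }) (positive , bounded))) distinct

  𝔖-unique : ∀ n → Unique (𝔖 n)
  𝔖-unique n = Unique.filter⁺ unique? (words-unique n (Unique.map⁺ ℕ.suc-injective (Unique.upTo⁺ n)))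

  ≤∧≢⇒≤ : ∀ {a} → a ≤ suc n → a ≢ suc n → a ≤ n
  ≤∧≢⇒≤ a≤ a≢ = ℕ.≤-pred (ℕ.≤∧≢⇒< a≤ a≢)

  absent-bounded : suc n ∉ π → All (_≤ suc n) π → All (_≤ n) π
  absent-bounded m∉π bounded =
    All.zipWith (λ (a≤ , m≢a) → ≤∧≢⇒≤ a≤ (≢-sym m≢a)) (bounded , All.¬Any⇒All¬ _ m∉π)

  delete-bounded : All (_≤ suc n) π → All (_≤ n) (delete (suc n) π)
  delete-bounded {n} {π} bounded = All.zipWith (λ (a≤ , a≢) → ≤∧≢⇒≤ a≤ a≢)
    (All.filter⁺ (λ a → ¬? (a ℕ.≟ suc n)) bounded , All.all-filter (λ a → ¬? (a ℕ.≟ suc n)) π)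

  length-insertion : ∀ π → σ ∈ insertions m π → length σ ≡ suc (length π)
  length-insertion π σ∈ = ↭-length (∈-insertions⇒↭ π σ∈)

  -- The pigeonhole principle, by induction on the largest letter allowed: `suc n` occurs at most
  -- once, so deleting it costs at most one letter.
  length-distinct : ∀ n π → All (0 <_) π → All (_≤ n) π → Unique π → length π ≤ n
  length-distinct zero    []      positive       bounded       π! = z≤n
  length-distinct zero    (_ ∷ _) (s≤s _ ∷ _)    (() ∷ _)      π!
  length-distinct (suc n) π positive bounded π! with suc n ∈? π
  ... | yes m∈π = ℕ.≤-trans (ℕ.≤-reflexive (length-insertion (delete (suc n) π) (insertion-delete π π! m∈π)))
    (s≤s (length-distinct n (delete (suc n) π)
      (All.filter⁺ (λ a → ¬? (a ℕ.≟ suc n)) positive) (delete-bounded bounded)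
      (Unique.filter⁺ (λ a → ¬? (a ℕ.≟ suc n)) π!)))
  ... | no  m∉π = ℕ.m≤n⇒m≤1+n (length-distinct n π positive (absent-bounded m∉π bounded) π!)

  arrangement-max : Arrangement (suc n) π → suc n ∈ π
  arrangement-max {n} {π} (arrangement length≡ positive bounded π!) with suc n ∈? π
  ... | yes m∈π = m∈π
  ... | no  m∉π = contradiction
    (subst (_≤ n) length≡ (length-distinct n π positive (absent-bounded m∉π bounded) π!)) (ℕ.<⇒≱ ℕ.≤-refl)

  arrangement-delete : Arrangement (suc n) π → Arrangement n (delete (suc n) π)
  arrangement-delete {n} {π} p@(arrangement length≡ positive bounded π!) = record
    { length≡n = ℕ.suc-injective (trans
        (sym (length-insertion (delete (suc n) π) (insertion-delete π π! (arrangement-max p)))) length≡)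
    ; positive = All.filter⁺ (λ a → ¬? (a ℕ.≟ suc n)) positive
    ; bounded  = delete-bounded bounded
    ; distinct = Unique.filter⁺ (λ a → ¬? (a ℕ.≟ suc n)) π!
    }

  arrangement-≢max : Arrangement n π → All (_≢ suc n) π
  arrangement-≢max p = All.map (λ { a≤n refl → ℕ.<⇒≱ ℕ.≤-refl a≤n }) (Arrangement.bounded p)

  arrangement-insertion : Arrangement n π → σ ∈ insertions (suc n) π → Arrangement (suc n) σ
  arrangement-insertion {n} {π} p@(arrangement refl positive bounded π!) σ∈ = record
    { length≡n = ↭-length σ↭
    ; positive = All-resp-↭ (↭-sym σ↭) (s≤s z≤n ∷ positive)
    ; bounded  = All-resp-↭ (↭-sym σ↭) (ℕ.≤-refl ∷ All.map ℕ.m≤n⇒m≤1+n bounded)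
    ; distinct = Unique-resp-↭ (↭⇒↭ₛ (↭-sym σ↭)) (All.map ≢-sym (arrangement-≢max p) ∷ π!)
    }
    where σ↭ = ∈-insertions⇒↭ π σ∈

  -- Deleting the largest letter recovers the permutation from an insertion, so no word is produced
  -- twice. The two lists order the same words differently, and duplicate-free lists with the same
  -- members are rearrangements of each other; sums do not see the difference.
  𝔖-suc : ∀ n → 𝔖 (suc n) ↭ concatMap (insertions (suc n)) (𝔖 n)
  𝔖-suc n = ∼bag⇒↭ (unique∧set⇒bag (𝔖-unique (suc n))
    (concatMap-unique (delete (suc n)) (𝔖 n) (𝔖-unique n)
      (λ {π} π∈ → insertions-unique π (arrangement-≢max (𝔖⁻ n π∈)))
      (λ {π} π∈ σ∈ → delete-insertion π (arrangement-≢max (𝔖⁻ n π∈)) σ∈))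
    (mk⇔
      (λ σ∈ → let p = 𝔖⁻ (suc n) σ∈ in ∈-concatMap⁺ (insertions (suc n))
        (lose (𝔖⁺ (arrangement-delete p)) (insertion-delete _ (Arrangement.distinct p) (arrangement-max p))))
      (λ σ∈ → let π , π∈ , σ∈π = find (∈-concatMap⁻ (insertions (suc n)) {xs = 𝔖 n} σ∈) in
        𝔖⁺ (arrangement-insertion (𝔖⁻ n π∈) σ∈π))))

  -- Up-down runs and turns

  -- The number of turns in a ∷ w when a is reached by an ascent, respectively
  -- by a descent.

  mutual
    turns↑ turns↓ : ℕ → Word → ℕ
    turns↑ a []      = 0
    turns↑ a (b ∷ w) with a ℕ.<? b
    ... | yes _ = turns↑ b w
    ... | no  _ = suc (turns↓ b w)
    turns↓ a []      = 0
    turns↓ a (b ∷ w) with a ℕ.<? b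
    ... | yes _ = suc (turns↑ b w)
    ... | no  _ = turns↓ b w

  turns↑-< : ∀ {a b} w → a < b → turns↑ a (b ∷ w) ≡ turns↑ b w
  turns↑-< {a} {b} w a<b with a ℕ.<? b
  ... | yes _   = refl
  ... | no  a≮b = contradiction a<b a≮b

  turns↑-≮ : ∀ {a b} w → ¬ a < b → turns↑ a (b ∷ w) ≡ suc (turns↓ b w)
  turns↑-≮ {a} {b} w a≮b with a ℕ.<? b
  ... | yes a<b = contradiction a<b a≮b
  ... | no  _   = refl

  turns↓-< : ∀ {a b} w → a < b → turns↓ a (b ∷ w) ≡ suc (turns↑ b w)
  turns↓-< {a} {b} w a<b with a ℕ.<? b
  ... | yes _   = refl
  ... | no  a≮b = contradiction a<b a≮b

  turns↓-≮ : ∀ {a b} w → ¬ a < b → turns↓ a (b ∷ w) ≡ turns↓ b w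
  turns↓-≮ {a} {b} w a≮b with a ℕ.<? b
  ... | yes a<b = contradiction a<b a≮b
  ... | no  _   = refl

  -- Letters are numbered from 0; past the end the value is junk.

  _!_ : Word → ℕ → ℕ
  []      ! k     = 0
  (a ∷ w) ! zero  = a
  (a ∷ w) ! suc k = w ! k

  linked⇒! : Linked R w → ∀ k → suc k < length w → R (w ! k) (w ! suc k)
  linked⇒! [-]        zero    (s≤s ())
  linked⇒! (Rab ∷ Rw) zero    _       = Rab
  linked⇒! (Rab ∷ Rw) (suc k) (s≤s <) = linked⇒! Rw k <
  linked⇒! [-]        (suc k) (s≤s ())

  !⇒linked : ∀ w → (∀ k → suc k < length w → R (w ! k) (w ! suc k)) → Linked R w
  !⇒linked []          h = []
  !⇒linked (a ∷ [])    h = [-]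
  !⇒linked (a ∷ b ∷ w) h = h 0 (s≤s (s≤s z≤n)) ∷ !⇒linked (b ∷ w) (λ k < → h (suc k) (s≤s <))

  take-! : ∀ n w → k < n → take n w ! k ≡ w ! k
  take-!             (suc n) []      _       = refl
  take-! {k = zero}  (suc n) (a ∷ w) _       = refl
  take-! {k = suc k} (suc n) (a ∷ w) (s≤s <) = take-! n w <

  drop-! : ∀ i w → drop i w ! k ≡ w ! (i ℕ.+ k)
  drop-! zero    w       = refl
  drop-! (suc i) []      = refl
  drop-! (suc i) (a ∷ w) = drop-! i w

  <∸⇒+< : ∀ i → k < j ∸ i → i ℕ.+ k < j
  <∸⇒+<             zero    k<j   = k<j
  <∸⇒+< {j = suc j} (suc i) k<j-i = s≤s (<∸⇒+< i k<j-i)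

  length-segment : ∀ w i → j ≤ length w → length (segment w (i , j)) ≡ j ∸ i
  length-segment {j} w i j≤ = trans (length-take (j ∸ i) (drop i w))
    (trans (cong ((j ∸ i) ℕ.⊓_) (length-drop i w)) (ℕ.m≤n⇒m⊓n≡m (ℕ.∸-monoˡ-≤ i j≤)))

  segment-! : ∀ w i → k < j ∸ i → segment w (i , j) ! k ≡ w ! (i ℕ.+ k)
  segment-! {j = j} w i k< = trans (take-! (j ∸ i) (drop i w) k<) (drop-! i w)

  -- R relates consecutive letters in the positions i, …, j ∸ 1.

  Along : Rel ℕ 0ℓ → Word → ℕ → ℕ → Set
  Along R w i j = ∀ k → i ≤ k → suc k < j → R (w ! k) (w ! suc k)

  -- Trades `segment` for bounds on positions in `w` itself; enlarging or shrinking an interval then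
  -- only changes the bounds.
  segment⇒along : ∀ w i j → j ≤ length w → Linked R (segment w (i , j)) → Along R w i j
  segment⇒along {R} w i j j≤ Rs k i≤k k+1<j = subst₂ R
    (trans (segment-! w i (ℕ.<-trans ℕ.≤-refl 1+[k-i]<j-i)) (cong (w !_) (ℕ.m+[n∸m]≡n i≤k)))
    (trans (segment-! w i 1+[k-i]<j-i) (cong (w !_) (trans (ℕ.+-suc i (k ∸ i)) (cong suc (ℕ.m+[n∸m]≡n i≤k)))))
    (linked⇒! Rs (k ∸ i) (subst (suc (k ∸ i) <_) (sym (length-segment w i j≤)) 1+[k-i]<j-i))
    where
    1+[k-i]<j-i : suc (k ∸ i) < j ∸ i
    1+[k-i]<j-i = subst (_< j ∸ i) (ℕ.+-∸-assoc 1 i≤k) (ℕ.∸-monoˡ-< k+1<j (ℕ.m≤n⇒m≤1+n i≤k))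

  along⇒segment : ∀ w i j → j ≤ length w → Along R w i j → Linked R (segment w (i , j))
  along⇒segment {R} w i j j≤ Rw = !⇒linked (segment w (i , j)) λ k k+1< →
    let k+1<j-i = subst (suc k <_) (length-segment w i j≤) k+1< in
    subst₂ R (sym (segment-! w i (ℕ.<-trans ℕ.≤-refl k+1<j-i)))
      (sym (trans (segment-! w i k+1<j-i) (cong (w !_) (ℕ.+-suc i k))))
      (Rw (i ℕ.+ k) (ℕ.m≤m+n i k) (subst (_< j) (ℕ.+-suc i k) (<∸⇒+< i k+1<j-i)))

  along-pair : R (w ! i) (w ! suc i) → Along R w i (2 ℕ.+ i)
  along-pair {R} {w} Rw k i≤k (s≤s (s≤s k≤i)) = subst (λ k → R (w ! k) (w ! suc k)) (ℕ.≤-antisym i≤k k≤i) Rw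

  along-snoc : Along R w i (suc j) → R (w ! j) (w ! suc j) → Along R w i (2 ℕ.+ j)
  along-snoc {R} {w} {j = j} Rw Rj k i≤k (s≤s k+1≤j+1) with ℕ.m≤n⇒m<n∨m≡n k+1≤j+1
  ... | inj₁ k+1<j+1 = Rw k i≤k k+1<j+1
  ... | inj₂ refl    = Rj

  along-cons : R (w ! i) (w ! suc i) → Along R w (suc i) j → Along R w i j
  along-cons Ri Rw k i≤k k+1<j with ℕ.m≤n⇒m<n∨m≡n i≤k
  ... | inj₁ i<k  = Rw k i<k k+1<j
  ... | inj₂ refl = Ri

  along-extendˡ : B.Decidable R → ∀ w i j → Along R w i j →
    ∃ λ i₀ → i₀ ≤ i × Along R w i₀ j × (∀ i′ → suc i′ ≡ i₀ → ¬ R (w ! i′) (w ! i₀))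
  along-extendˡ R? w zero    j Rw = 0 , z≤n , Rw , λ _ ()
  along-extendˡ {R} R? w (suc i) j Rw with R? (w ! i) (w ! suc i)
  ... | no ¬Ri = suc i , ℕ.≤-refl , Rw , λ { _ refl → ¬Ri }
  ... | yes Ri = let i₀ , i₀≤i , Rw₀ , stop = along-extendˡ R? w i j (along-cons {R} {w} Ri Rw) in
    i₀ , ℕ.m≤n⇒m≤1+n i₀≤i , Rw₀ , stop

  -- The run through the step from `q` to `suc q` is extended to the left as far as `R` holds, while
  -- the hypothesis on `suc q` blocks the right. `S` is the opposite order: an interval containing
  -- this one also contains the step at `q`, where `R` excludes `S`.
  maximal-run : ∀ {S : Rel ℕ 0ℓ} → B.Decidable R → (∀ {a b} → R a b → ¬ S a b) → ∀ w q →
    R (w ! q) (w ! suc q) → (2 ℕ.+ q < length w → ¬ R (w ! suc q) (w ! (2 ℕ.+ q))) →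
    ∃ λ i₀ → i₀ ≤ q × Along R w i₀ (2 ℕ.+ q) ×
      (∀ {i j} → i ≤ i₀ → 2 ℕ.+ q ≤ j → j ≤ length w → Along R w i j ⊎ Along S w i j → (i , j) ≡ (i₀ , 2 ℕ.+ q))
  maximal-run {R} {S} R? R⇒¬S w q Rq end
    with i₀ , i₀≤q , Rw , stop ← along-extendˡ R? w q (2 ℕ.+ q) (along-pair {R} {w} Rq) =
    i₀ , i₀≤q , Rw , maximal
    where
    maximal : ∀ {i j} → i ≤ i₀ → 2 ℕ.+ q ≤ j → j ≤ length w →
              Along R w i j ⊎ Along S w i j → (i , j) ≡ (i₀ , 2 ℕ.+ q)
    maximal i≤i₀ q+2≤j j≤ (inj₂ Sw) = contradiction (Sw q (ℕ.≤-trans i≤i₀ i₀≤q) q+2≤j) (R⇒¬S Rq)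
    maximal i≤i₀ q+2≤j j≤ (inj₁ Rw′) with ℕ.m≤n⇒m<n∨m≡n q+2≤j
    ... | inj₁ q+2<j =
      contradiction (Rw′ (suc q) (ℕ.m≤n⇒m≤1+n (ℕ.≤-trans i≤i₀ i₀≤q)) q+2<j) (end (ℕ.<-≤-trans q+2<j j≤))
    ... | inj₂ refl with ℕ.m≤n⇒m<n∨m≡n i≤i₀
    ...   | inj₂ refl            = refl
    ...   | inj₁ (s≤s {n = i′} i≤i′) =
      contradiction (Rw′ i′ i≤i′ (ℕ.≤-trans (s≤s i₀≤q) (ℕ.n≤1+n (suc q)))) (stop i′ refl)

  Turn : ℕ → ℕ → ℕ → Set
  Turn a b c = (a < b × c < b) ⊎ (b < a × b < c)

  turn? : ∀ a b c → Dec (Turn a b c)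
  turn? a b c = ((a ℕ.<? b) ×-dec (c ℕ.<? b)) ⊎-dec ((b ℕ.<? a) ×-dec (b ℕ.<? c))

  -- The positions in b ∷ w of the turns of a ∷ b ∷ w, and the last position.

  ends : ℕ → ℕ → Word → List ℕ
  ends a b []      = 0 ∷ []
  ends a b (c ∷ w) with turn? a b c
  ... | yes _ = 0 ∷ map suc (ends b c w)
  ... | no  _ = map suc (ends b c w)

  -- Membership in `ends` in terms of positions. Since `p` counts from the second letter, the letter
  -- in question is `w ! suc p`, and the first alternative says that it is the last one.
  End : Word → ℕ → Set
  End w p = 2 ℕ.+ p ≡ length w ⊎ 2 ℕ.+ p < length w × Turn (w ! p) (w ! suc p) (w ! (2 ℕ.+ p))

  End-∷ : ∀ {a p} → End w p → End (a ∷ w) (suc p)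
  End-∷ = Sum.map (cong suc) (λ (< , turn) → s≤s < , turn)

  End-∷⁻ : ∀ {a p} → End (a ∷ w) (suc p) → End w p
  End-∷⁻ = Sum.map ℕ.suc-injective (λ (< , turn) → ℕ.s<s⁻¹ < , turn)

  ∈-ends⁻ : ∀ a b w {p} → p ∈ ends a b w → End (a ∷ b ∷ w) p
  ∈-ends⁻ a b []      (here refl) = inj₁ refl
  ∈-ends⁻ a b (c ∷ w) p∈ with turn? a b c
  ∈-ends⁻ a b (c ∷ w) (here refl) | yes turn = inj₂ (s≤s (s≤s (s≤s z≤n)) , turn)
  ∈-ends⁻ a b (c ∷ w) (there p∈)  | yes _ with _ , q∈ , refl ← ∈-map⁻ suc p∈ =
    End-∷ {b ∷ c ∷ w} {a} (∈-ends⁻ b c w q∈)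
  ∈-ends⁻ a b (c ∷ w) p∈          | no  _ with _ , q∈ , refl ← ∈-map⁻ suc p∈ =
    End-∷ {b ∷ c ∷ w} {a} (∈-ends⁻ b c w q∈)

  ∈-ends⁺ : ∀ a b w {p} → End (a ∷ b ∷ w) p → p ∈ ends a b w
  ∈-ends⁺ a b []      {zero}  _               = here refl
  ∈-ends⁺ a b []      {suc p} (inj₁ ())
  ∈-ends⁺ a b []      {suc p} (inj₂ (s≤s (s≤s ()) , _))
  ∈-ends⁺ a b (c ∷ w) {p} end with turn? a b c
  ∈-ends⁺ a b (c ∷ w) {zero}  end               | yes _    = here refl
  ∈-ends⁺ a b (c ∷ w) {suc p} end               | yes _    = there (∈-map⁺ suc (∈-ends⁺ b c w (End-∷⁻ {b ∷ c ∷ w} {a} end)))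
  ∈-ends⁺ a b (c ∷ w) {zero}  (inj₂ (_ , turn)) | no ¬turn = contradiction turn ¬turn
  ∈-ends⁺ a b (c ∷ w) {suc p} end               | no _     = ∈-map⁺ suc (∈-ends⁺ b c w (End-∷⁻ {b ∷ c ∷ w} {a} end))

  ends-unique : ∀ a b w → Unique (ends a b w)
  ends-unique a b []      = [] ∷ []
  ends-unique a b (c ∷ w) with turn? a b c
  ... | yes _ = All.map⁺ (All.universal (λ _ ()) _) ∷ Unique.map⁺ ℕ.suc-injective (ends-unique b c w)
  ... | no  _ = Unique.map⁺ ℕ.suc-injective (ends-unique b c w)

  mutual
    -- The direction in which `b` is reached decides which comparison of `b` and `c` is a turn, and
    -- a turn exchanges the two directions. The additional one is the last position.
    length-ends↑ : ∀ {a b} w → Linked _≢_ (b ∷ w) → a < b → length (ends a b w) ≡ suc (turns↑ b w)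
    length-ends↑ []      _          a<b = refl
    length-ends↑ {a} {b} (c ∷ w) (b≢c ∷ w≢) a<b with turn? a b c | ℕ.<-cmp b c
    ... | _                    | tri≈ _ b≡c _   = contradiction b≡c b≢c
    ... | yes _                | tri> b≮c _ c<b =
      cong suc (trans (length-map suc (ends b c w)) (trans (length-ends↓ w w≢ c<b) (sym (turns↑-≮ w b≮c))))
    ... | no  _                | tri< b<c _ _   =
      trans (length-map suc (ends b c w)) (trans (length-ends↑ w w≢ b<c) (cong suc (sym (turns↑-< w b<c))))
    ... | yes (inj₁ (_ , c<b)) | tri< b<c _ _   = contradiction b<c (ℕ.<⇒≯ c<b)
    ... | yes (inj₂ (b<a , _)) | tri< _   _ _   = contradiction a<b (ℕ.<⇒≯ b<a)
    ... | no  ¬turn            | tri> _   _ c<b = contradiction (inj₁ (a<b , c<b)) ¬turn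

    length-ends↓ : ∀ {a b} w → Linked _≢_ (b ∷ w) → b < a → length (ends a b w) ≡ suc (turns↓ b w)
    length-ends↓ []      _          b<a = refl
    length-ends↓ {a} {b} (c ∷ w) (b≢c ∷ w≢) b<a with turn? a b c | ℕ.<-cmp b c
    ... | _                    | tri≈ _ b≡c _   = contradiction b≡c b≢c
    ... | yes _                | tri< b<c _ _   =
      cong suc (trans (length-map suc (ends b c w)) (trans (length-ends↑ w w≢ b<c) (sym (turns↓-< w b<c))))
    ... | no  _                | tri> b≮c _ c<b =
      trans (length-map suc (ends b c w)) (trans (length-ends↓ w w≢ c<b) (cong suc (sym (turns↓-≮ w b≮c))))
    ... | yes (inj₁ (a<b , _)) | tri> _   _ _   = contradiction a<b (ℕ.<⇒≯ b<a)
    ... | yes (inj₂ (_ , b<c)) | tri> b≮c _ _   = contradiction b<c b≮c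
    ... | no  ¬turn            | tri< b<c _ _   = contradiction (inj₂ (b<a , b<c)) ¬turn

  -- Maximal intervals and their right ends.

  ∈-intervals⁻ : ∀ w → (i , j) ∈ intervals w → i < j × j ≤ length w
  ∈-intervals⁻ w I∈ =
    let I∈× , i<j = ∈-filter⁻ (λ (i , j) → i ℕ.<? j) I∈
        _ , j∈ = ∈-cartesianProduct⁻ (upTo (suc (length w))) (upTo (suc (length w))) I∈×
    in i<j , ℕ.≤-pred (∈-upTo⁻ j∈)

  ∈-intervals⁺ : ∀ w → i < j → j ≤ length w → (i , j) ∈ intervals w
  ∈-intervals⁺ w i<j j≤ = ∈-filter⁺ (λ (i , j) → i ℕ.<? j)
    (∈-cartesianProduct⁺ (∈-upTo⁺ (ℕ.<-trans i<j (s≤s j≤))) (∈-upTo⁺ (s≤s j≤))) i<j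

  intervals-unique : ∀ w → Unique (intervals w)
  intervals-unique w = Unique.filter⁺ (λ (i , j) → i ℕ.<? j)
    (Unique.cartesianProduct⁺ (Unique.upTo⁺ (suc (length w))) (Unique.upTo⁺ (suc (length w))))

  maximal⇒≡ : ∀ {Q i j i′ j′} w → Maximal Q w (i , j) → i′ < j′ → j′ ≤ length w → i′ ≤ i → j ≤ j′ →
              Q (segment w (i′ , j′)) → (i′ , j′) ≡ (i , j)
  maximal⇒≡ w (_ , max) i′<j′ j′≤ i′≤i j≤j′ Qs = All.lookup max (∈-intervals⁺ w i′<j′ j′≤) (i′≤i , j≤j′) Qs

  maximal⁺ : ∀ {Q i j} w → Q (segment w (i , j)) →
             (∀ {i′ j′} → i′ < j′ → j′ ≤ length w → i′ ≤ i → j ≤ j′ → Q (segment w (i′ , j′)) → (i′ , j′) ≡ (i , j)) →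
             Maximal Q w (i , j)
  maximal⁺ w Qs max = Qs , All.tabulate λ J∈ (i′≤i , j≤j′) Qs′ →
    let i′<j′ , j′≤ = ∈-intervals⁻ w J∈ in max i′<j′ j′≤ i′≤i j≤j′ Qs′

  maximal-same-end : ∀ {Q i i′ j} w → j ≤ length w → i < j → i′ < j →
                     Maximal Q w (i , j) → Maximal Q w (i′ , j) → i ≡ i′
  maximal-same-end {Q} {i} {i′} w j≤ i<j i′<j m m′ with ℕ.≤-total i i′
  ... | inj₁ i≤i′ = cong proj₁ (maximal⇒≡ {Q} w m′ i<j j≤ i≤i′ ℕ.≤-refl (proj₁ m))
  ... | inj₂ i′≤i = cong proj₁ (sym (maximal⇒≡ {Q} w m i′<j j≤ i′≤i ℕ.≤-refl (proj₁ m′)))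

  -- Maximal intervals with a common right end are nested, hence equal; a right end 1 forces the
  -- left end 0, which settles the run of one letter. Up-down runs are thus determined by their
  -- right ends.
  upDownRun-same-end : ∀ {i i′ j} w → j ≤ length w → i < j → i′ < j →
                       UpDownRun w (i , j) → UpDownRun w (i′ , j) → i ≡ i′
  upDownRun-same-end w j≤ i<j i′<j (inj₁ (_ , m)) (inj₁ (_ , m′)) = maximal-same-end {Monotone} w j≤ i<j i′<j m m′
  upDownRun-same-end w j≤ (s≤s z≤n) (s≤s z≤n) (inj₂ (refl , _)) _ = refl
  upDownRun-same-end w j≤ (s≤s z≤n) (s≤s z≤n) (inj₁ _) (inj₂ (refl , _)) = refl

  map-unique : ∀ {X Y : Set} {f : X → Y} xs → (∀ {x y} → x ∈ xs → y ∈ xs → f x ≡ f y → x ≡ y) →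
               Unique xs → Unique (map f xs)
  map-unique []       f-inj []          = []
  map-unique (x ∷ xs) f-inj (x∉xs ∷ xs!) =
    All.map⁺ (All.tabulate λ y∈ fx≡fy → All.lookup x∉xs y∈ (f-inj (here refl) (there y∈) fx≡fy))
    ∷ map-unique xs (λ x∈ y∈ → f-inj (there x∈) (there y∈)) xs!

  -- Up-down runs are counted by their right ends. The letter 0 put in front
  -- makes the run (0 , 1) end in a turn, like every other run but the last.

  module _ (a : ℕ) (w : Word) (0<a : 0 < a) (u≢ : Linked _≢_ (a ∷ w)) where

    private
      u = a ∷ w

    -- A birun that stops before the end of the word does so because the next step reverses
    -- direction: a step in the same direction would extend it. Likewise an ascent after the first
    -- letter would extend the run `(0 , 1)`.
    upDownRun⇒end : ∀ i j → i < j → j ≤ length u → UpDownRun u (i , j) → ∃ λ p → suc p ≡ j × End (0 ∷ u) p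
    upDownRun⇒end i j i<j j≤ (inj₁ (2≤ , birun))
      with subst (_< j) (ℕ.+-comm i 1) (<∸⇒+< i (subst (2 ≤_) (length-segment u i j≤) 2≤))
    ... | s≤s (s≤s {n = q} i≤q) =
      suc q , refl , Sum.swap (Sum.map (λ j< → s≤s j< , turn j<) (cong suc) (ℕ.m≤n⇒m<n∨m≡n j≤))
      where
      longer : 3 ℕ.+ q ≤ length u → ¬ Monotone (segment u (i , 3 ℕ.+ q))
      longer j< mono = contradiction
        (cong proj₂ (maximal⇒≡ {Monotone} u birun (ℕ.m≤n⇒m≤1+n i<j) j< ℕ.≤-refl (ℕ.n≤1+n (2 ℕ.+ q)) mono)) ℕ.1+n≢n
      turn : 2 ℕ.+ q < length u → Turn (u ! q) (u ! suc q) (u ! (2 ℕ.+ q))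
      turn j< with proj₁ birun | ℕ.<-cmp (u ! suc q) (u ! (2 ℕ.+ q))
      ... | _        | tri≈ _ b≡c _   = contradiction b≡c (linked⇒! u≢ (suc q) j<)
      ... | inj₁ inc | tri> _ _ c<b   = inj₁ (segment⇒along u i (2 ℕ.+ q) j≤ inc q i≤q ℕ.≤-refl , c<b)
      ... | inj₂ dec | tri< b<c _ _   = inj₂ (segment⇒along u i (2 ℕ.+ q) j≤ dec q i≤q ℕ.≤-refl , b<c)
      ... | inj₁ inc | tri< b<c _ _   = contradiction
        (inj₁ (along⇒segment u i (3 ℕ.+ q) j< (along-snoc {_<_} {u} (segment⇒along u i (2 ℕ.+ q) j≤ inc) b<c))) (longer j<)
      ... | inj₂ dec | tri> _ _ c<b   = contradiction
        (inj₂ (along⇒segment u i (3 ℕ.+ q) j< (along-snoc {_>_} {u} (segment⇒along u i (2 ℕ.+ q) j≤ dec) c<b))) (longer j<)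
    upDownRun⇒end _ _ i<j j≤ (inj₂ (refl , run)) =
      0 , refl , Sum.swap (Sum.map (λ j< → s≤s j< , inj₁ (0<a , descent j<)) (cong suc) (ℕ.m≤n⇒m<n∨m≡n j≤))
      where
      descent : 1 < length u → u ! 1 < u ! 0
      descent j< with ℕ.<-cmp (u ! 0) (u ! 1)
      ... | tri> _ _ b<a = b<a
      ... | tri≈ _ a≡b _ = contradiction a≡b (linked⇒! u≢ 0 j<)
      ... | tri< a<b _ _ = contradiction (cong proj₂ (maximal⇒≡ {Increasing} u run (s≤s z≤n) j< z≤n (ℕ.n≤1+n 1)
        (along⇒segment u 0 2 j< (along-pair {_<_} {u} a<b)))) λ ()

    -- For `p = 0`, the turn after the 0 in front, or the absence of a second letter, excludes an
    -- initial ascent, so the first letter is an increasing run by itself. For `p = suc q`, the step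
    -- from `q` to `suc q` fixes the direction and `maximal-run` supplies the left end.
    end⇒upDownRun : ∀ p → End (0 ∷ u) p → ∃ λ i → i < suc p × suc p ≤ length u × UpDownRun u (i , suc p)
    end⇒upDownRun zero    end = 0 , s≤s z≤n , s≤s z≤n , inj₂ (refl ,
      maximal⁺ {Increasing} u (along⇒segment {_<_} u 0 1 (s≤s z≤n) λ { _ _ (s≤s ()) }) maximal)
      where
      maximal : ∀ {i j} → i < j → j ≤ length u → i ≤ 0 → 1 ≤ j → Increasing (segment u (i , j)) → (i , j) ≡ (0 , 1)
      maximal {j = j} _ j≤ z≤n 1≤j inc with ℕ.m≤n⇒m<n∨m≡n 1≤j
      ... | inj₂ refl = refl
      ... | inj₁ 1<j = contradiction (segment⇒along u 0 j j≤ inc 0 z≤n 1<j) (no-ascent end)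
        where
        no-ascent : End (0 ∷ u) 0 → ¬ u ! 0 < u ! 1
        no-ascent (inj₁ 2≡)                   _   = ℕ.<-irrefl (ℕ.suc-injective 2≡) (ℕ.<-≤-trans 1<j j≤)
        no-ascent (inj₂ (_ , inj₁ (_ , b<a))) a<b = ℕ.<⇒≯ a<b b<a
        no-ascent (inj₂ (_ , inj₂ (() , _)))  _
    end⇒upDownRun (suc q) end = run (ℕ.<-cmp (u ! q) (u ! suc q))
      where
      j≤ : 2 ℕ.+ q ≤ length u
      j≤ = Sum.[ (λ eq → ℕ.≤-reflexive (ℕ.suc-injective eq)) , (λ (< , _) → ℕ.<⇒≤ (ℕ.s<s⁻¹ <)) ] end
      Goal : Set
      Goal = ∃ λ i → i < 2 ℕ.+ q × 2 ℕ.+ q ≤ length u × UpDownRun u (i , 2 ℕ.+ q)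
      birun : ∀ i → i ≤ q → Along _<_ u i (2 ℕ.+ q) ⊎ Along _>_ u i (2 ℕ.+ q) →
              (∀ {i′ j′} → i′ ≤ i → 2 ℕ.+ q ≤ j′ → j′ ≤ length u → Along _<_ u i′ j′ ⊎ Along _>_ u i′ j′ →
               (i′ , j′) ≡ (i , 2 ℕ.+ q)) → Goal
      birun i i≤q mono max = i , s≤s (ℕ.m≤n⇒m≤1+n i≤q) , j≤ , inj₁
        ( subst (2 ≤_) (sym (trans (length-segment u i j≤) (ℕ.+-∸-assoc 2 i≤q))) (ℕ.m≤m+n 2 (q ∸ i))
        , maximal⁺ {Monotone} u (Sum.map (along⇒segment u i (2 ℕ.+ q) j≤) (along⇒segment u i (2 ℕ.+ q) j≤) mono)
            λ {i′} {j′} _ j′≤ i′≤i j≤j′ mono′ →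
              max i′≤i j≤j′ j′≤ (Sum.map (segment⇒along u i′ j′ j′≤) (segment⇒along u i′ j′ j′≤) mono′))
      run : B.Tri (u ! q < u ! suc q) (u ! q ≡ u ! suc q) (u ! q > u ! suc q) → Goal
      run (tri≈ _ a≡b _) = contradiction a≡b (linked⇒! u≢ q j≤)
      run (tri< a<b _ b≮a) =
        let i , i≤q , inc , max = maximal-run {_<_} {S = _>_} ℕ._<?_ ℕ.<⇒≯ u q a<b (stop end)
        in birun i i≤q (inj₁ inc) max
        where
        stop : End (0 ∷ u) (suc q) → 2 ℕ.+ q < length u → ¬ u ! suc q < u ! (2 ℕ.+ q)
        stop (inj₁ eq)                   j< _   = ℕ.<-irrefl (ℕ.suc-injective eq) j<
        stop (inj₂ (_ , inj₁ (_ , c<b))) _  b<c = ℕ.<⇒≯ b<c c<b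
        stop (inj₂ (_ , inj₂ (b<a , _))) _  _   = b≮a b<a
      run (tri> a≮b _ b<a) =
        let i , i≤q , dec , max = maximal-run {_>_} {S = _<_} ℕ._>?_ (λ b<a a<b → ℕ.<⇒≯ b<a a<b) u q b<a (stop end)
        in birun i i≤q (inj₂ dec) (λ i′≤i j≤j′ j′≤ → max i′≤i j≤j′ j′≤ ∘ Sum.swap)
        where
        stop : End (0 ∷ u) (suc q) → 2 ℕ.+ q < length u → ¬ u ! (2 ℕ.+ q) < u ! suc q
        stop (inj₁ eq)                   j< _   = ℕ.<-irrefl (ℕ.suc-injective eq) j<
        stop (inj₂ (_ , inj₁ (a<b , _))) _  _   = a≮b a<b
        stop (inj₂ (_ , inj₂ (_ , b<c))) _  c<b = ℕ.<⇒≯ b<c c<b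

    udr≡1+turns : udr u ≡ suc (turns↑ a w)
    udr≡1+turns = begin
      length upDownRuns                      ≡⟨ length-map proj₂ upDownRuns ⟨
      length (map proj₂ upDownRuns)          ≡⟨ ↭-length (∼bag⇒↭ (unique∧set⇒bag right-ends! (Unique.map⁺ ℕ.suc-injective (ends-unique 0 a w))
                                                  (mk⇔ to from))) ⟩
      length (map suc (ends 0 a w))          ≡⟨ length-map suc (ends 0 a w) ⟩
      length (ends 0 a w)                    ≡⟨ length-ends↑ w u≢ 0<a ⟩
      suc (turns↑ a w)                       ∎
      where
      open ≡-Reasoning
      upDownRuns = filter (upDownRun? u) (intervals u)
      bounds : ∀ {i j} → (i , j) ∈ upDownRuns → i < j × j ≤ length u × UpDownRun u (i , j)
      bounds I∈ = let I∈′ , run = ∈-filter⁻ (upDownRun? u) {xs = intervals u} I∈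
                      i<j , j≤ = ∈-intervals⁻ u I∈′
                  in i<j , j≤ , run
      right-ends! : Unique (map proj₂ upDownRuns)
      right-ends! = map-unique upDownRuns
        (λ { {i , j} {i′ , j} I∈ J∈ refl → let i<j , j≤ , run = bounds I∈; i′<j , _ , run′ = bounds J∈ in
             cong (_, j) (upDownRun-same-end u j≤ i<j i′<j run run′) })
        (Unique.filter⁺ (upDownRun? u) (intervals-unique u))
      to : ∀ {j} → j ∈ map proj₂ upDownRuns → j ∈ map suc (ends 0 a w)
      to j∈ with (i , j) , I∈ , refl ← ∈-map⁻ proj₂ j∈ =
        let i<j , j≤ , run = bounds I∈
            _ , 1+p≡j , end = upDownRun⇒end i j i<j j≤ run
        in subst (_∈ map suc (ends 0 a w)) 1+p≡j (∈-map⁺ suc (∈-ends⁺ 0 a w end))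
      from : ∀ {j} → j ∈ map suc (ends 0 a w) → j ∈ map proj₂ upDownRuns
      from j∈ with p , p∈ , refl ← ∈-map⁻ suc j∈ =
        let i , i<j , j≤ , run = end⇒upDownRun p (∈-ends⁻ 0 a w p∈)
        in ∈-map⁺ proj₂ (∈-filter⁺ (upDownRun? u) (∈-intervals⁺ u i<j j≤) run)

  -- Agrees with `udr` on permutations, but is computed letter by letter and on every word, so sums
  -- over insertions can be evaluated by recursion.
  runs : Word → ℕ
  runs []      = 0
  runs (a ∷ w) = suc (turns↑ a w)

  udr≡runs : ∀ n → π ∈ 𝔖 n → udr π ≡ runs π
  udr≡runs {[]}    n π∈ = refl
  udr≡runs {a ∷ w} n π∈ with arrangement _ (0<a ∷ _) _ π! ← 𝔖⁻ n π∈ = udr≡1+turns a w 0<a (AllPairs⇒Linked π!)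

  𝔖-length : ∀ n → π ∈ 𝔖 n → length π ≡ n
  𝔖-length n π∈ = Arrangement.length≡n (𝔖⁻ n π∈)

  𝔖-letters : ∀ n → π ∈ 𝔖 n → All (_< suc n) π
  𝔖-letters n π∈ = All.map s≤s (Arrangement.bounded (𝔖⁻ n π∈))

  insertions-𝔖 : ∀ n → π ∈ 𝔖 n → σ ∈ insertions (suc n) π → σ ∈ 𝔖 (suc n)
  insertions-𝔖 n π∈ σ∈ = 𝔖⁺ (arrangement-insertion (𝔖⁻ n π∈) σ∈)

open Words using (insertions; des-descent; des-ascent; turns↑; turns↓; turns↑-<; turns↑-≮; turns↓-<; turns↓-≮; runs;
  udr≡runs; 𝔖-suc; 𝔖-length; 𝔖-letters; insertions-𝔖)

-- Recurrences and derivations over a commutative ring with a map from ℚ.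

module Algebraic
  (R : CommutativeRing 0ℓ 0ℓ)
  (morphism : ℚ.+-*-rawRing -Raw-AlmostCommutative⟶ fromCommutativeRing R)
  where

  open CommutativeRing R
  open _-Raw-AlmostCommutative⟶_ morphism using (⟦_⟧; 0-homo; 1-homo)
  open import Algebra.Properties.Semiring.Exp semiring using (_^_)
  open Relation.Binary.Reasoning.Setoid setoid

  module Solver = Algebra.Solver.Ring ℚ.+-*-rawRing (fromCommutativeRing R) morphism
    (λ a b → Maybe.map (λ a≡b → reflexive (≡.cong ⟦_⟧ a≡b)) (dec⇒weaklyDec ℚ._≟_ a b))
  open Solver using (solve; con; var; _:+_; _:*_; _:-_; _:^_; _:=_; Polynomial)

  -- x⁰ denotes 1#, whereas con 1ℚ would denote ⟦ 1ℚ ⟧.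
  :1 :2 : ∀ {n} → Polynomial (suc n)
  :1 = var Fin.zero :^ 0
  :2 = con (1ℚ ℚ.+ 1ℚ)

  2# : Carrier
  2# = ⟦ 1ℚ ℚ.+ 1ℚ ⟧

  -- κ 0 is ⟦ 0ℚ ⟧ and not 0#, so that the solver can treat it as con 0ℚ.
  κ : ℕ → Carrier
  κ zero    = ⟦ 0ℚ ⟧
  κ (suc k) = 1# + κ k

  Σ : {A : Set} → List A → (A → Carrier) → Carrier
  Σ xs f = foldr _+_ 0# (map f xs)

  -- Turns a consequence of p ≈ q into an identity for the solver.
  by-difference : ∀ {l r p q} → p ≈ q → l - r ≈ p - q → l ≈ r
  by-difference {l} {r} {p} {q} p≈q l-r≈p-q = begin
    l               ≈⟨ solve 2 (λ l r → l := (l :- r) :+ r) refl l r ⟩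
    (l - r) + r     ≈⟨ +-congʳ l-r≈p-q ⟩
    (p - q) + r     ≈⟨ +-congʳ (+-congʳ p≈q) ⟩
    (q - q) + r     ≈⟨ solve 2 (λ q r → (q :- q) :+ r := r) refl q r ⟩
    r               ∎

  -- Finite sums, and sums over the insertions into a word.

  Σ-cong : ∀ {A : Set} {f g : A → Carrier} xs → (∀ {x} → x ∈ xs → f x ≈ g x) → Σ xs f ≈ Σ xs g
  Σ-cong []       f≈g = refl
  Σ-cong (x ∷ xs) f≈g = +-cong (f≈g (here ≡.refl)) (Σ-cong xs (f≈g ∘ there))

  Σ-+ : ∀ {A : Set} (f g : A → Carrier) xs → Σ xs (λ x → f x + g x) ≈ Σ xs f + Σ xs g
  Σ-+ f g []       = sym (+-identityˡ 0#)
  Σ-+ f g (x ∷ xs) = trans (+-congˡ (Σ-+ f g xs))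
    (solve 4 (λ a b c d → (a :+ b) :+ (c :+ d) := (a :+ c) :+ (b :+ d)) refl (f x) (g x) (Σ xs f) (Σ xs g))

  *-Σ : ∀ {A : Set} c (f : A → Carrier) xs → c * Σ xs f ≈ Σ xs (λ x → c * f x)
  *-Σ c f []       = zeroʳ c
  *-Σ c f (x ∷ xs) = trans (distribˡ c (f x) (Σ xs f)) (+-congˡ (*-Σ c f xs))

  Σ-map : ∀ {A B : Set} (f : B → Carrier) (h : A → B) xs → Σ (map h xs) f ≡ Σ xs (f ∘ h)
  Σ-map f h []       = ≡.refl
  Σ-map f h (x ∷ xs) = ≡.cong (f (h x) +_) (Σ-map f h xs)

  Σ-++ : ∀ {A : Set} (f : A → Carrier) xs ys → Σ (xs ++ ys) f ≈ Σ xs f + Σ ys f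
  Σ-++ f []       ys = sym (+-identityˡ (Σ ys f))
  Σ-++ f (x ∷ xs) ys = trans (+-congˡ (Σ-++ f xs ys)) (sym (+-assoc (f x) (Σ xs f) (Σ ys f)))

  Σ-concatMap : ∀ {A B : Set} (f : B → Carrier) (h : A → List B) xs →
                Σ (concatMap h xs) f ≈ Σ xs (λ x → Σ (h x) f)
  Σ-concatMap f h []       = refl
  Σ-concatMap f h (x ∷ xs) = trans (Σ-++ f (h x) (concatMap h xs)) (+-congˡ (Σ-concatMap f h xs))

  Σ-↭ : ∀ {A : Set} (f : A → Carrier) {xs ys} → xs ↭ ys → Σ xs f ≈ Σ ys f
  Σ-↭ f ↭.refl         = refl
  Σ-↭ f (↭.prep x p)   = +-congˡ (Σ-↭ f p)
  Σ-↭ f (↭.swap {xs = xs} {ys = ys} x y p) = trans (+-congˡ (+-congˡ (Σ-↭ f p)))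
    (solve 3 (λ a b c → a :+ (b :+ c) := b :+ (a :+ c)) refl (f x) (f y) (Σ ys f))
  Σ-↭ f (↭.trans p q)  = trans (Σ-↭ f p) (Σ-↭ f q)

  Σ-insertions-∷ : ∀ m b w {f g : Word → Carrier} {c} → f (m ∷ b ∷ w) ≈ c → (∀ σ → f (b ∷ σ) ≈ g σ) →
                   Σ (insertions m (b ∷ w)) f ≈ c + Σ (insertions m w) g
  Σ-insertions-∷ m b w {f} p q = +-cong p
    (trans (reflexive (Σ-map f (b ∷_) (insertions m w))) (Σ-cong (insertions m w) (λ {σ} _ → q σ)))

  -- κ d * F (suc d) is moved to the left to avoid the subtraction length w - d;
  -- likewise below.
  Σ-insertions-des-∷ : ∀ {m} (F : ℕ → Carrier) a w → a < m → All (_< m) w → let d = des (a ∷ w) in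
    Σ (insertions m w) (λ σ → F (des (a ∷ σ))) + κ d * F (suc d) ≈ κ (suc d) * F d + κ (length w) * F (suc d)
  Σ-insertions-des-∷ {m} F a [] a<m [] = begin
    F (des (a ∷ m ∷ [])) + 0# + κ 0 * F 1
      ≈⟨ +-congʳ (+-identityʳ (F (des (a ∷ m ∷ [])))) ⟩
    F (des (a ∷ m ∷ [])) + κ 0 * F 1
      ≈⟨ +-congʳ (reflexive (≡.cong F (des-ascent [] (ℕ.<⇒≯ a<m)))) ⟩
    F 0 + κ 0 * F 1
      ≈⟨ solve 2 (λ f₀ f₁ → f₀ :+ con 0ℚ :* f₁ := (:1 :+ con 0ℚ) :* f₀ :+ con 0ℚ :* f₁) refl (F 0) (F 1) ⟩
    κ 1 * F 0 + κ 0 * F 1 ∎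
  Σ-insertions-des-∷ {m} F a (b ∷ w) a<m (b<m ∷ w<m) with b ℕ.<? a
  -- The descent from `a` to `b` is present in the remaining insertions, hence `F ∘ suc`; when `m`
  -- comes between them, the descent from `m` to `b` replaces it.
  ... | yes b<a rewrite des-descent w b<a = trans
    (+-congʳ (Σ-insertions-∷ m b w {f = λ σ → F (des (a ∷ σ))}
      (reflexive (≡.cong F (≡.trans (des-ascent (b ∷ w) (ℕ.<⇒≯ a<m)) (des-descent w b<m))))
      (λ σ → reflexive (≡.cong F (des-descent σ b<a)))))
    (by-difference (Σ-insertions-des-∷ (F ∘ suc) b w b<m w<m)
      (solve 5 (λ S d n f₁ f₂ →
          ((f₁ :+ S) :+ (:1 :+ d) :* f₂) :- ((:1 :+ (:1 :+ d)) :* f₁ :+ (:1 :+ n) :* f₂)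
        := (S :+ d :* f₂) :- ((:1 :+ d) :* f₁ :+ n :* f₂))
        refl (Σ (insertions m w) (λ σ → F (suc (des (b ∷ σ))))) (κ (des (b ∷ w))) (κ (length w))
        (F (suc (des (b ∷ w)))) (F (suc (suc (des (b ∷ w)))))))
  ... | no  b≮a rewrite des-ascent w b≮a = trans
    (+-congʳ (Σ-insertions-∷ m b w {f = λ σ → F (des (a ∷ σ))}
      (reflexive (≡.cong F (≡.trans (des-ascent (b ∷ w) (ℕ.<⇒≯ a<m)) (des-descent w b<m))))
      (λ σ → reflexive (≡.cong F (des-ascent σ b≮a)))))
    (by-difference (Σ-insertions-des-∷ F b w b<m w<m)
      (solve 5 (λ S d n f₀ f₁ →
          ((f₁ :+ S) :+ d :* f₁) :- ((:1 :+ d) :* f₀ :+ (:1 :+ n) :* f₁)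
        := (S :+ d :* f₁) :- ((:1 :+ d) :* f₀ :+ n :* f₁))
        refl (Σ (insertions m w) (λ σ → F (des (b ∷ σ)))) (κ (des (b ∷ w))) (κ (length w))
        (F (des (b ∷ w))) (F (suc (des (b ∷ w))))))

  -- The insertions that keep the number of descents are the one at the end and one inside each
  -- descent; insertion in front or inside an ascent adds one.
  Σ-insertions-des : ∀ {m} (F : ℕ → Carrier) a w → a < m → All (_< m) w → let d = des (a ∷ w) in
    Σ (insertions m (a ∷ w)) (F ∘ des) + κ (suc d) * F (suc d) ≈ κ (suc d) * F d + κ (suc (suc (length w))) * F (suc d)
  Σ-insertions-des {m} F a w a<m w<m = trans
    (+-congʳ (Σ-insertions-∷ m a w {f = F ∘ des} {g = λ σ → F (des (a ∷ σ))}
      (reflexive (≡.cong F (des-descent w a<m))) (λ σ → refl)))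
    (by-difference (Σ-insertions-des-∷ F a w a<m w<m)
      (solve 5 (λ S d n f₀ f₁ →
          ((f₁ :+ S) :+ (:1 :+ d) :* f₁) :- ((:1 :+ d) :* f₀ :+ (:1 :+ (:1 :+ n)) :* f₁)
        := (S :+ d :* f₁) :- ((:1 :+ d) :* f₀ :+ n :* f₁))
        refl (Σ (insertions m w) (λ σ → F (des (a ∷ σ)))) (κ (des (a ∷ w))) (κ (length w))
        (F (des (a ∷ w))) (F (suc (des (a ∷ w))))))

  -- The summand F (suc (turns↓ a w)) accounts for the insertion in front of a.
  mutual
    Σ-insertions-turns↑ : ∀ {m} (F : ℕ → Carrier) a w → a < m → All (_< m) w → let k = turns↑ a w in
      F (suc (turns↓ a w)) + Σ (insertions m w) (λ σ → F (turns↑ a σ)) + κ k * F (2 ℕ.+ k)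
        ≈ κ (suc k) * F k + F (suc k) + κ (length w) * F (2 ℕ.+ k)
    Σ-insertions-turns↑ {m} F a [] a<m [] = begin
      F 1 + (F (turns↑ a (m ∷ [])) + 0#) + κ 0 * F 2
        ≈⟨ +-congʳ (+-congˡ (+-identityʳ (F (turns↑ a (m ∷ []))))) ⟩
      F 1 + F (turns↑ a (m ∷ [])) + κ 0 * F 2
        ≈⟨ +-congʳ (+-congˡ (reflexive (≡.cong F (turns↑-< [] a<m)))) ⟩
      F 1 + F 0 + κ 0 * F 2
        ≈⟨ solve 3 (λ f₀ f₁ f₂ → f₁ :+ f₀ :+ con 0ℚ :* f₂ := (:1 :+ con 0ℚ) :* f₀ :+ f₁ :+ con 0ℚ :* f₂)
             refl (F 0) (F 1) (F 2) ⟩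
      κ 1 * F 0 + F 1 + κ 0 * F 2 ∎
    Σ-insertions-turns↑ {m} F a (b ∷ w) a<m (b<m ∷ w<m) with a ℕ.<? b
    -- `m` between `a` and `b` gives the extra summand of the induction hypothesis for `b`, while
    -- the extra summand of the goal is now known to be `F (2 ℕ.+ k)`.
    ... | yes a<b = trans
      (+-congʳ (+-congˡ (Σ-insertions-∷ m b w {f = λ σ → F (turns↑ a σ)}
        (reflexive (≡.cong F (≡.trans (turns↑-< (b ∷ w) a<m) (turns↑-≮ w (ℕ.<⇒≯ b<m)))))
        (λ σ → reflexive (≡.cong F (turns↑-< σ a<b))))))
      (by-difference (Σ-insertions-turns↑ F b w b<m w<m)
        (solve 7 (λ S k n f₀ f₁ f₂ e →
            (f₂ :+ (e :+ S) :+ k :* f₂) :- ((:1 :+ k) :* f₀ :+ f₁ :+ (:1 :+ n) :* f₂)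
          := (e :+ S :+ k :* f₂) :- ((:1 :+ k) :* f₀ :+ f₁ :+ n :* f₂))
          refl (Σ (insertions m w) (λ σ → F (turns↑ b σ))) (κ k) (κ (length w))
          (F k) (F (suc k)) (F (2 ℕ.+ k)) (F (suc (turns↓ b w)))))
      where k = turns↑ b w
    ... | no  a≮b = trans
      (+-congʳ (+-congˡ (Σ-insertions-∷ m b w {f = λ σ → F (turns↑ a σ)}
        (reflexive (≡.cong F (≡.trans (turns↑-< (b ∷ w) a<m) (turns↑-≮ w (ℕ.<⇒≯ b<m)))))
        (λ σ → reflexive (≡.cong F (turns↑-≮ σ a≮b))))))
      (by-difference (Σ-insertions-turns↓ (F ∘ suc) b w b<m w<m)
        (solve 6 (λ S k n f₁ f₂ f₃ →
            (f₁ :+ (f₁ :+ S) :+ (:1 :+ k) :* f₃) :- ((:1 :+ (:1 :+ k)) :* f₁ :+ f₂ :+ (:1 :+ n) :* f₃)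
          := (S :+ k :* f₃) :- (k :* f₁ :+ f₂ :+ n :* f₃))
          refl (Σ (insertions m w) (λ σ → F (suc (turns↓ b σ)))) (κ k) (κ (length w))
          (F (suc k)) (F (2 ℕ.+ k)) (F (3 ℕ.+ k))))
      where k = turns↓ b w

    -- No extra summand occurs here: after a descent from `a` to `b`, a letter `m` between them is
    -- followed by a descent to `b` again, so the resulting count depends only on `turns↓ b w`.
    Σ-insertions-turns↓ : ∀ {m} (F : ℕ → Carrier) a w → a < m → All (_< m) w → let k = turns↓ a w in
      Σ (insertions m w) (λ σ → F (turns↓ a σ)) + κ k * F (2 ℕ.+ k)
        ≈ κ k * F k + F (suc k) + κ (length w) * F (2 ℕ.+ k)
    Σ-insertions-turns↓ {m} F a [] a<m [] = begin
      F (turns↓ a (m ∷ [])) + 0# + κ 0 * F 2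
        ≈⟨ +-congʳ (+-identityʳ (F (turns↓ a (m ∷ [])))) ⟩
      F (turns↓ a (m ∷ [])) + κ 0 * F 2
        ≈⟨ +-congʳ (reflexive (≡.cong F (turns↓-< [] a<m))) ⟩
      F 1 + κ 0 * F 2
        ≈⟨ solve 3 (λ f₀ f₁ f₂ → f₁ :+ con 0ℚ :* f₂ := con 0ℚ :* f₀ :+ f₁ :+ con 0ℚ :* f₂)
             refl (F 0) (F 1) (F 2) ⟩
      κ 0 * F 0 + F 1 + κ 0 * F 2 ∎
    Σ-insertions-turns↓ {m} F a (b ∷ w) a<m (b<m ∷ w<m) with a ℕ.<? b
    ... | yes a<b = trans
      (+-congʳ (Σ-insertions-∷ m b w {f = λ σ → F (turns↓ a σ)}
        (reflexive (≡.cong F (≡.trans (turns↓-< (b ∷ w) a<m) (≡.cong suc (turns↑-≮ w (ℕ.<⇒≯ b<m))))))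
        (λ σ → reflexive (≡.cong F (turns↓-< σ a<b)))))
      (by-difference (Σ-insertions-turns↑ (F ∘ suc) b w b<m w<m)
        (solve 7 (λ S k n f₁ f₂ f₃ e →
            (e :+ S :+ (:1 :+ k) :* f₃) :- ((:1 :+ k) :* f₁ :+ f₂ :+ (:1 :+ n) :* f₃)
          := (e :+ S :+ k :* f₃) :- ((:1 :+ k) :* f₁ :+ f₂ :+ n :* f₃))
          refl (Σ (insertions m w) (λ σ → F (suc (turns↑ b σ)))) (κ k) (κ (length w))
          (F (suc k)) (F (2 ℕ.+ k)) (F (3 ℕ.+ k)) (F (2 ℕ.+ turns↓ b w))))
      where k = turns↑ b w
    ... | no  a≮b = trans
      (+-congʳ (Σ-insertions-∷ m b w {f = λ σ → F (turns↓ a σ)}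
        (reflexive (≡.cong F (≡.trans (turns↓-< (b ∷ w) a<m) (≡.cong suc (turns↑-≮ w (ℕ.<⇒≯ b<m))))))
        (λ σ → reflexive (≡.cong F (turns↓-≮ σ a≮b)))))
      (by-difference (Σ-insertions-turns↓ F b w b<m w<m)
        (solve 6 (λ S k n f₀ f₁ f₂ →
            ((f₂ :+ S) :+ k :* f₂) :- (k :* f₀ :+ f₁ :+ (:1 :+ n) :* f₂)
          := (S :+ k :* f₂) :- (k :* f₀ :+ f₁ :+ n :* f₂))
          refl (Σ (insertions m w) (λ σ → F (turns↓ b σ))) (κ k) (κ (length w))
          (F k) (F (suc k)) (F (2 ℕ.+ k))))
      where k = turns↓ b w

  -- The extra summand of `Σ-insertions-turns↑` is exactly the insertion in front of the whole word,
  -- so here it is absorbed into the sum.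
  Σ-insertions-runs : ∀ {m} (F : ℕ → Carrier) a w → a < m → All (_< m) w → let k = runs (a ∷ w) in
    Σ (insertions m (a ∷ w)) (F ∘ runs) + κ k * F (2 ℕ.+ k)
      ≈ κ k * F k + F (suc k) + κ (suc (length w)) * F (2 ℕ.+ k)
  Σ-insertions-runs {m} F a w a<m w<m = trans
    (+-congʳ (Σ-insertions-∷ m a w {f = F ∘ runs} {g = λ σ → F (suc (turns↑ a σ))}
      (reflexive (≡.cong (F ∘ suc) (turns↑-≮ w (ℕ.<⇒≯ a<m)))) (λ σ → refl)))
    (by-difference (Σ-insertions-turns↑ (F ∘ suc) a w a<m w<m)
      (solve 7 (λ S k n f₁ f₂ f₃ e →
          (e :+ S :+ (:1 :+ k) :* f₃) :- ((:1 :+ k) :* f₁ :+ f₂ :+ (:1 :+ n) :* f₃)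
        := (e :+ S :+ k :* f₃) :- ((:1 :+ k) :* f₁ :+ f₂ :+ n :* f₃))
        refl (Σ (insertions m w) (λ σ → F (suc (turns↑ a σ)))) (κ k) (κ (length w))
        (F (suc k)) (F (2 ℕ.+ k)) (F (3 ℕ.+ k)) (F (2 ℕ.+ turns↓ a w))))
    where k = turns↑ a w

  -- Recurrences for A_n and P_n.

  A′ P′ : ℕ → Carrier → Carrier
  A′ n x = Σ (𝔖 n) (λ π → x ^ suc (des π))
  P′ n x = Σ (𝔖 n) (λ π → x ^ udr π)

  -- The values of x·d/dx at A_n(x) and P_n(x).
  θA θP : ℕ → Carrier → Carrier
  θA n x = Σ (𝔖 n) (λ π → κ (suc (des π)) * x ^ suc (des π))
  θP n x = Σ (𝔖 n) (λ π → κ (udr π) * x ^ udr π)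

  -- The number `d + 1` of insertions that keep d descents is the exponent of the monomial, which
  -- turns the count into `A_{n+1} = (1 - x) x A_n' + (n + 1) x A_n`.
  A-suc : ∀ m x → let n = suc m in A′ (suc n) x + x * θA n x ≈ θA n x + κ (suc n) * (x * A′ n x)
  A-suc m x = begin
    A′ (suc n) x + x * θA n x
      ≈⟨ +-cong (trans (Σ-↭ F∘des (𝔖-suc n)) (Σ-concatMap F∘des (insertions (suc n)) (𝔖 n))) (*-Σ x _ (𝔖 n)) ⟩
    Σ (𝔖 n) (λ π → Σ (insertions (suc n) π) F∘des) + Σ (𝔖 n) (λ π → x * (κ (suc (des π)) * F∘des π))
      ≈⟨ Σ-+ _ _ (𝔖 n) ⟨
    Σ (𝔖 n) (λ π → Σ (insertions (suc n) π) F∘des + x * (κ (suc (des π)) * F∘des π))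
      ≈⟨ Σ-cong (𝔖 n) pointwise ⟩
    Σ (𝔖 n) (λ π → κ (suc (des π)) * F∘des π + κ (suc n) * (x * F∘des π))
      ≈⟨ Σ-+ _ _ (𝔖 n) ⟩
    θA n x + Σ (𝔖 n) (λ π → κ (suc n) * (x * F∘des π))
      ≈⟨ +-congˡ (trans (*-congˡ (*-Σ x _ (𝔖 n))) (*-Σ (κ (suc n)) _ (𝔖 n))) ⟨
    θA n x + κ (suc n) * (x * A′ n x) ∎
    where
    n = suc m
    F∘des : Word → Carrier
    F∘des π = x ^ suc (des π)
    pointwise : ∀ {π} → π ∈ 𝔖 n →
      Σ (insertions (suc n) π) F∘des + x * (κ (suc (des π)) * F∘des π) ≈ κ (suc (des π)) * F∘des π + κ (suc n) * (x * F∘des π)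
    pointwise {[]}    π∈ with () ← 𝔖-length n π∈
    pointwise {a ∷ w} π∈ with a<m ∷ w<m ← 𝔖-letters n π∈ = by-difference
      (trans (Σ-insertions-des (λ d → x ^ suc d) a w a<m w<m)
        (+-congˡ (*-congʳ (reflexive (≡.cong (κ ∘ suc) (𝔖-length n π∈))))))
      (solve 5 (λ S d n x y → (S :+ x :* (d :* y)) :- (d :* y :+ n :* (x :* y)) := (S :+ d :* (x :* y)) :- (d :* y :+ n :* (x :* y)))
        refl (Σ (insertions (suc n) (a ∷ w)) F∘des) (κ (suc (des (a ∷ w)))) (κ (suc n)) x (F∘des (a ∷ w)))

  -- The number k of insertions that keep k runs is again the exponent, and two more runs mean a
  -- factor z²: `P_{n+1} = (1 - z²) z P_n' + (z + n z²) P_n`.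
  P-suc : ∀ m z → let n = suc m in
          P′ (suc n) z + z * (z * θP n z) ≈ θP n z + z * P′ n z + κ n * (z * (z * P′ n z))
  P-suc m z = begin
    P′ (suc n) z + z * (z * θP n z)
      ≈⟨ +-cong (trans (Σ-↭ F∘udr (𝔖-suc n)) (Σ-concatMap F∘udr (insertions (suc n)) (𝔖 n)))
           (trans (*-congˡ (*-Σ z _ (𝔖 n))) (*-Σ z _ (𝔖 n))) ⟩
    Σ (𝔖 n) (λ π → Σ (insertions (suc n) π) F∘udr) + Σ (𝔖 n) (λ π → z * (z * (κ (udr π) * F∘udr π)))
      ≈⟨ Σ-+ _ _ (𝔖 n) ⟨
    Σ (𝔖 n) (λ π → Σ (insertions (suc n) π) F∘udr + z * (z * (κ (udr π) * F∘udr π)))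
      ≈⟨ Σ-cong (𝔖 n) pointwise ⟩
    Σ (𝔖 n) (λ π → κ (udr π) * F∘udr π + z * F∘udr π + κ n * (z * (z * F∘udr π)))
      ≈⟨ trans (Σ-+ _ _ (𝔖 n)) (+-congʳ (Σ-+ _ _ (𝔖 n))) ⟩
    θP n z + Σ (𝔖 n) (λ π → z * F∘udr π) + Σ (𝔖 n) (λ π → κ n * (z * (z * F∘udr π)))
      ≈⟨ +-cong (+-congˡ (*-Σ z _ (𝔖 n)))
           (trans (*-congˡ (trans (*-congˡ (*-Σ z _ (𝔖 n))) (*-Σ z _ (𝔖 n)))) (*-Σ (κ n) _ (𝔖 n))) ⟨
    θP n z + z * P′ n z + κ n * (z * (z * P′ n z)) ∎
    where
    n = suc m
    F∘udr : Word → Carrier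
    F∘udr π = z ^ udr π
    pointwise : ∀ {π} → π ∈ 𝔖 n →
      Σ (insertions (suc n) π) F∘udr + z * (z * (κ (udr π) * F∘udr π))
        ≈ κ (udr π) * F∘udr π + z * F∘udr π + κ n * (z * (z * F∘udr π))
    pointwise {[]}    π∈ with () ← 𝔖-length n π∈
    pointwise {a ∷ w} π∈ with a<m ∷ w<m ← 𝔖-letters n π∈ rewrite udr≡runs n π∈ = trans
      (+-congʳ (Σ-cong (insertions (suc n) (a ∷ w)) λ σ∈ → reflexive (≡.cong (z ^_) (udr≡runs (suc n) (insertions-𝔖 n π∈ σ∈)))))
      (by-difference
        (trans (Σ-insertions-runs (z ^_) a w a<m w<m)
          (+-congˡ (*-congʳ (reflexive (≡.cong κ (𝔖-length n π∈))))))
        (solve 5 (λ S k n z y →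
            (S :+ z :* (z :* (k :* y))) :- (k :* y :+ z :* y :+ n :* (z :* (z :* y)))
          := (S :+ k :* (z :* (z :* y))) :- (k :* y :+ z :* y :+ n :* (z :* (z :* y))))
          refl (Σ (insertions (suc n) (a ∷ w)) (λ σ → z ^ runs σ)) (κ (runs (a ∷ w))) (κ n) z (z ^ runs (a ∷ w))))

  -- Derivations and the common recurrence.

  record Derivation : Set where
    field
      δ      : Carrier → Carrier
      δ-cong : ∀ {f g} → f ≈ g → δ f ≈ δ g
      δ-+    : ∀ f g → δ (f + g) ≈ δ f + δ g
      δ-*    : ∀ f g → δ (f * g) ≈ δ f * g + f * δ g
      δ-⟦⟧   : ∀ c → δ ⟦ c ⟧ ≈ ⟦ 0ℚ ⟧

    δ-1 : δ 1# ≈ ⟦ 0ℚ ⟧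
    δ-1 = trans (δ-cong (sym 1-homo)) (δ-⟦⟧ 1ℚ)

    δ-⟦⟧* : ∀ c f → δ (⟦ c ⟧ * f) ≈ ⟦ c ⟧ * δ f
    δ-⟦⟧* c f = trans (δ-* ⟦ c ⟧ f) (trans (+-congʳ (*-congʳ (δ-⟦⟧ c)))
      (solve 3 (λ c f d → con 0ℚ :* f :+ c :* d := c :* d) refl ⟦ c ⟧ f (δ f)))

    -- The logarithmic derivative of `z ^ k` is k times that of `z`. The latter is `c / y`, and the
    -- denominator `y` is kept on the left because it need not be invertible.
    δ-^ : ∀ {y z c} → y * δ z ≈ c * z → ∀ k → y * δ (z ^ k) ≈ c * (κ k * z ^ k)
    δ-^ {y} {z} {c} h zero    = trans (*-congˡ δ-1)
      (solve 2 (λ y c → y :* con 0ℚ := c :* (con 0ℚ :* :1)) refl y c)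
    δ-^ {y} {z} {c} h (suc k) = trans (*-congˡ (δ-* z (z ^ k)))
      (by-difference (+-cong (*-congʳ {z ^ k} h) (*-congˡ {z} (δ-^ h k)))
        (solve 7 (λ y z c k p d e →
            y :* (d :* p :+ z :* e) :- c :* ((:1 :+ k) :* (z :* p))
          := (y :* d :* p :+ z :* (y :* e)) :- (c :* z :* p :+ z :* (c :* (k :* p))))
          refl y z c (κ k) (z ^ k) (δ z) (δ (z ^ k))))

    δ-^-suc : ∀ f m → δ (f ^ suc m) ≈ κ (suc m) * (f ^ m * δ f)
    δ-^-suc f zero    = trans (δ-* f 1#) (trans (+-congˡ (*-congˡ δ-1))
      (solve 2 (λ f d → d :* :1 :+ f :* con 0ℚ := (:1 :+ con 0ℚ) :* (:1 :* d)) refl f (δ f)))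
    δ-^-suc f (suc m) = trans (δ-* f (f ^ suc m)) (trans (+-congˡ (*-congˡ (δ-^-suc f m)))
      (solve 4 (λ f p d k → d :* (f :* p) :+ f :* (k :* (p :* d)) := (:1 :+ k) :* ((f :* p) :* d)) refl f (f ^ m) (δ f) (κ (suc m))))

    δ-Σ : ∀ {A : Set} {y c} (f : A → Carrier) (g : A → Carrier) xs →
          (∀ x → y * δ (f x) ≈ c * g x) → y * δ (Σ xs f) ≈ c * Σ xs g
    δ-Σ {y = y} {c} f g []       h = begin
      y * δ 0#        ≈⟨ *-congˡ (trans (δ-cong (sym 0-homo)) (trans (δ-⟦⟧ 0ℚ) 0-homo)) ⟩
      y * 0#          ≈⟨ trans (zeroʳ y) (sym (zeroʳ c)) ⟩
      c * 0#          ∎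
    δ-Σ {y = y} {c} f g (x ∷ xs) h = begin
      y * δ (f x + Σ xs f)          ≈⟨ *-congˡ (δ-+ (f x) (Σ xs f)) ⟩
      y * (δ (f x) + δ (Σ xs f))    ≈⟨ distribˡ y _ _ ⟩
      y * δ (f x) + y * δ (Σ xs f)  ≈⟨ +-cong (h x) (δ-Σ f g xs h) ⟩
      c * g x + c * Σ xs g          ≈⟨ distribˡ c _ _ ⟨
      c * (g x + Σ xs g)            ∎

    module _ x z (δx≈x : δ x ≈ x) (z[1+x²]≈2x : z * (1# + x ^ 2) ≈ 2# * x) where

      private
        y = 1# + x ^ 2
        :y : ∀ {n} → Polynomial (suc n) → Polynomial (suc n)
        :y x = :1 :+ x :^ 2

      step : ℕ → Carrier → Carrier
      step n f = (1# - x ^ 2) * δ f + (2# * x + 2# * (κ n * x ^ 2)) * f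

      step-cong : ∀ n {f g} → f ≈ g → step n f ≈ step n g
      step-cong n f≈g = +-cong (*-congˡ (δ-cong f≈g)) (*-congˡ f≈g)

      δ-A : ∀ n → δ (A′ n x) ≈ θA n x
      δ-A n = trans (sym (*-identityˡ _)) (trans
        (δ-Σ _ _ (𝔖 n) λ π → δ-^ {1#} {x} {1#} (*-congˡ δx≈x) (suc (des π))) (*-identityˡ _))

      δ[1+x] : δ (1# + x) ≈ x
      δ[1+x] = trans (δ-+ 1# x) (trans (+-cong δ-1 δx≈x) (solve 1 (λ x → con 0ℚ :+ x := x) refl x))

      δy : δ y ≈ 2# * (x * x)
      δy = trans (δ-+ 1# (x ^ 2)) (trans (+-cong δ-1 (trans (δ-^-suc x 1) (*-congˡ (*-congˡ δx≈x))))
        (solve 1 (λ x → con 0ℚ :+ (:1 :+ (:1 :+ con 0ℚ)) :* (x :* :1 :* x) := :2 :* (x :* x)) refl x))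

      -- Applying δ to `z y = 2x` gives `y δ z + 2x² z = 2x = z y`, and `y - 2x² = 1 - x²`.
      yδz : y * δ z ≈ (1# - x ^ 2) * z
      yδz = by-difference (+-cong (trans (sym (trans (δ-* z y) (+-congˡ (*-congˡ δy))))
               (trans (δ-cong z[1+x²]≈2x) (trans (δ-⟦⟧* _ x) (*-congˡ δx≈x)))) (sym z[1+x²]≈2x))
        (solve 3 (λ x z d → :y x :* d :- (:1 :- x :^ 2) :* z
          := ((d :* :y x :+ z :* (:2 :* (x :* x))) :+ :2 :* x) :- (:2 :* x :+ z :* :y x)) refl x z (δ z))

      yδP : ∀ n → y * δ (P′ n z) ≈ (1# - x ^ 2) * θP n z
      yδP n = δ-Σ _ _ (𝔖 n) λ π → δ-^ yδz (udr π)

      A-step : ∀ m → 2# * (1# + x) ^ suc m * A′ (suc (suc m)) x ≈ step (suc m) (2# * (1# + x) ^ m * A′ (suc m) x)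
      A-step m = trans
        (by-difference
          (+-cong (*-congˡ {2# * ((1# + x) * E)} (A-suc m x))
            -- For `E = (1 + x)^m` one has `(1 + x) δ E = m x E`. The factor `1 - x²` of `step`
            -- supplies the `1 + x`, so the exponent m - 1 never appears.
            (*-congˡ {2# * ((1# - x) * A)} (sym (δ-^ {1# + x} {1# + x} {x} (trans (*-congˡ δ[1+x]) (*-comm _ _)) m))))
          (solve 7 (λ x κ A A₁ K E dE →
              :2 :* ((:1 :+ x) :* E) :* A₁ :-
                ((:1 :- x :^ 2) :* (:2 :* (dE :* A :+ E :* K)) :+ (:2 :* x :+ :2 :* ((:1 :+ κ) :* x :^ 2)) :* (:2 :* E :* A))
            := (:2 :* ((:1 :+ x) :* E) :* (A₁ :+ x :* K) :+ :2 :* ((:1 :- x) :* A) :* (x :* (κ :* E))) :-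
               (:2 :* ((:1 :+ x) :* E) :* (K :+ (:1 :+ (:1 :+ κ)) :* (x :* A)) :+ :2 :* ((:1 :- x) :* A) :* ((:1 :+ x) :* dE)))
            refl x (κ m) A (A′ (suc (suc m)) x) (θA (suc m) x) E (δ E)))
        (+-congʳ (*-congˡ (sym δL)))
        where
        E = (1# + x) ^ m
        A = A′ (suc m) x
        δL : δ (2# * E * A) ≈ 2# * (δ E * A + E * θA (suc m) x)
        δL = trans (δ-cong (*-assoc 2# E A)) (trans (δ-⟦⟧* _ (E * A))
          (*-congˡ (trans (δ-* E A) (+-congˡ (*-congˡ (δ-A (suc m)))))))

      -- `P-suc` is multiplied by `y² Y`, so that every z meets a `y` and `z y` becomes `2x`. The
      -- coefficient of `θP` is then `(y² - 4x²) Y = (1 - x²)² Y`; one factor `1 - x²` belongs to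
      -- `step`, the other turns `θP` into `y δ P`.
      P-step : ∀ m → y ^ suc (suc m) * P′ (suc (suc m)) z ≈ step (suc m) (y ^ suc m * P′ (suc m) z)
      P-step m = trans
        (by-difference scaled
          (solve 6 (λ x κ P P₁ K Y →
              (:y x :* (:y x :* Y)) :* P₁ :-
                ((:1 :- x :^ 2) :* ((κ :* (Y :* (:2 :* (x :* x)))) :* P :+ Y :* ((:1 :- x :^ 2) :* K))
                  :+ (:2 :* x :+ :2 :* (κ :* x :^ 2)) :* ((:y x :* Y) :* P))
            := (:y x :* :y x :* Y :* P₁ :+ Y :* K :* ((:2 :* x) :* (:2 :* x))) :-
               (:y x :* :y x :* Y :* K :+ :y x :* Y :* P :* (:2 :* x) :+ κ :* Y :* P :* ((:2 :* x) :* (:2 :* x))))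
            refl x (κ (suc m)) P (P′ (suc (suc m)) z) K Y))
        (+-congʳ (*-congˡ (sym δX)))
        where
        Y = y ^ m
        P = P′ (suc m) z
        K = θP (suc m) z
        δX : δ (y ^ suc m * P) ≈ (κ (suc m) * (Y * (2# * (x * x)))) * P + Y * ((1# - x ^ 2) * K)
        δX = trans (δ-* (y ^ suc m) P) (+-cong
          (*-congʳ (trans (δ-^-suc y m) (*-congˡ (*-congˡ δy))))
          (trans (solve 3 (λ y Y d → y :* Y :* d := Y :* (y :* d)) refl y Y (δ P)) (*-congˡ (yδP (suc m)))))
        [zy]²≈[2x]² : (z * y) * (z * y) ≈ (2# * x) * (2# * x)
        [zy]²≈[2x]² = *-cong z[1+x²]≈2x z[1+x²]≈2x
        scaled : y * y * Y * P′ (suc (suc m)) z + Y * K * ((2# * x) * (2# * x))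
               ≈ y * y * Y * K + y * Y * P * (2# * x) + κ (suc m) * Y * P * ((2# * x) * (2# * x))
        scaled = trans (+-congˡ (*-congˡ (sym [zy]²≈[2x]²))) (trans
          (by-difference (*-congˡ {y * y * Y} (P-suc m z))
            (solve 7 (λ y z κ P P₁ K Y →
                (y :* y :* Y :* P₁ :+ Y :* K :* ((z :* y) :* (z :* y))) :-
                  (y :* y :* Y :* K :+ y :* Y :* P :* (z :* y) :+ κ :* Y :* P :* ((z :* y) :* (z :* y)))
              := (y :* y :* Y :* (P₁ :+ z :* (z :* K))) :- (y :* y :* Y :* (K :+ z :* P :+ κ :* (z :* (z :* P)))))
              refl y z (κ (suc m)) P (P′ (suc (suc m)) z) K Y))
          (+-cong (+-congˡ (*-congˡ z[1+x²]≈2x)) (*-congˡ [zy]²≈[2x]²)))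

      A≈P : ∀ m → 2# * (1# + x) ^ m * A′ (suc m) x ≈ y ^ suc m * P′ (suc m) z
      A≈P zero    = begin
        2# * 1# * (x ^ 1 + 0#)
          ≈⟨ *-congˡ (+-identityʳ (x ^ 1)) ⟩
        2# * 1# * x ^ 1
          ≈⟨ by-difference (sym z[1+x²]≈2x) (solve 2 (λ x z →
               :2 :* :1 :* x :^ 1 :- (:y x) :^ 1 :* z :^ 1 := :2 :* x :- z :* :y x) refl x z) ⟩
        y ^ 1 * z ^ 1
          ≈⟨ *-congˡ (+-identityʳ (z ^ 1)) ⟨
        y ^ 1 * (z ^ 1 + 0#)   ∎
      A≈P (suc m) = trans (A-step m) (trans (step-cong (suc m) (A≈P m)) (sym (P-step m)))

  /-unique : ∀ b c d n r → d * r ≈ 1# → d * b ≈ n * c → b ≈ n * r * c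
  /-unique b c d n r dr≈1 db≈nc = by-difference
    (+-cong (*-congˡ {r} db≈nc) (*-congʳ {b} (sym dr≈1)))
    (solve 5 (λ b c d n r → b :- n :* r :* c := (r :* (d :* b) :+ :1 :* b) :- (r :* (n :* c) :+ d :* r :* b)) refl b c d n r)

  scale : Carrier → Derivation → Derivation
  scale s D = record
    { δ      = λ f → s * δ f
    ; δ-cong = λ f≈g → *-congˡ (δ-cong f≈g)
    ; δ-+    = λ f g → trans (*-congˡ (δ-+ f g)) (distribˡ s (δ f) (δ g))
    ; δ-*    = λ f g → trans (*-congˡ (δ-* f g))
        (solve 5 (λ s f g d e → s :* (d :* g :+ f :* e) := s :* d :* g :+ f :* (s :* e)) refl s f g (δ f) (δ g))
    ; δ-⟦⟧   = λ c → trans (*-congˡ (δ-⟦⟧ c)) (solve 1 (λ s → s :* con 0ℚ := con 0ℚ) refl s)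
    }
    where open Derivation D

  -- The quadratic equation for v and its derivative.

  module _ t v s (tv≈1-s : t * v ≈ 1# - s) (s²≈1-t² : s * s ≈ 1# - t ^ 2)
    (t-cancel : ∀ f g → t * f ≈ t * g → f ≈ g) where

    -- `v` is a root of `t v² - 2v + t`. After multiplication by `t` everything is expressed by
    -- `t v = 1 - s`, and `t² + (1 - s)² = 2 (1 - s)` because `s² = 1 - t²`.
    t[1+v²]≈2v : t * (1# + v ^ 2) ≈ 2# * v
    t[1+v²]≈2v = t-cancel _ _ (begin
      t * (t * (1# + v ^ 2))
        ≈⟨ solve 2 (λ t v → t :* (t :* (:1 :+ v :^ 2)) := t :^ 2 :+ (t :* v) :* (t :* v)) refl t v ⟩
      t ^ 2 + (t * v) * (t * v)
        ≈⟨ +-congˡ (*-cong tv≈1-s tv≈1-s) ⟩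
      t ^ 2 + (1# - s) * (1# - s)
        ≈⟨ by-difference s²≈1-t² (solve 2 (λ t s →
             (t :^ 2 :+ (:1 :- s) :* (:1 :- s)) :- :2 :* (:1 :- s) := s :* s :- (:1 :- t :^ 2)) refl t s) ⟩
      2# * (1# - s)
        ≈⟨ *-congˡ tv≈1-s ⟨
      2# * (t * v)
        ≈⟨ solve 2 (λ t v → :2 :* (t :* v) := t :* (:2 :* v)) refl t v ⟩
      t * (2# * v) ∎)

    -- Applying δ to `2v = t (1 + v²)` gives `2 δ v = 2v + 2 t v δ v`; halved, this is
    -- `(1 - t v) δ v = v`, where `1 - t v` is `s`.
    sδv≈v : ∀ (D : Derivation) → let open Derivation D in δ t ≈ t → s * δ v ≈ v
    sδv≈v D δt≈t = by-difference
      (+-cong (*-congˡ {⟦ ½ ⟧} (+-cong 2δv t[1+v²]≈2v)) (*-congʳ {δ v} tv≈1-s))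
      (solve 4 (λ t v s d →
          s :* d :- v
        := (con ½ :* (:2 :* d :+ t :* (:1 :+ v :^ 2)) :+ t :* v :* d) :-
           (con ½ :* ((t :* (:1 :+ v :^ 2) :+ t :* (:2 :* (v :* d))) :+ :2 :* v) :+ (:1 :- s) :* d))
        refl t v s (δ v))
      where
      open Derivation D
      2δv : 2# * δ v ≈ t * (1# + v ^ 2) + t * (2# * (v * δ v))
      2δv = begin
        2# * δ v              ≈⟨ δ-⟦⟧* _ v ⟨
        δ (2# * v)            ≈⟨ δ-cong t[1+v²]≈2v ⟨
        δ (t * (1# + v ^ 2))  ≈⟨ δ-* t (1# + v ^ 2) ⟩
        δ t * (1# + v ^ 2) + t * δ (1# + v ^ 2)
          ≈⟨ +-cong (*-congʳ δt≈t) (*-congˡ (trans (δ-+ 1# (v ^ 2)) (+-cong δ-1 (δ-^-suc v 1)))) ⟩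
        t * (1# + v ^ 2) + t * (⟦ 0ℚ ⟧ + κ 2 * (v ^ 1 * δ v))
          ≈⟨ solve 3 (λ t v d → t :* (:1 :+ v :^ 2) :+ t :* (con 0ℚ :+ (:1 :+ (:1 :+ con 0ℚ)) :* (v :^ 1 :* d))
               := t :* (:1 :+ v :^ 2) :+ t :* (:2 :* (v :* d))) refl t v (δ v) ⟩
        t * (1# + v ^ 2) + t * (2# * (v * δ v)) ∎

  /-cancel : ∀ d n r → d * r ≈ 1# → n * r * d ≈ n
  /-cancel d n r dr≈1 = trans
    (solve 3 (λ d n r → n :* r :* d := n :* (d :* r)) refl d n r)
    (trans (*-congˡ dr≈1) (*-identityʳ n))

-- The ring of formal power series

open Defs using (A; t; v; _≈_; _+_; _-_; _*_; _^_; 0#; 1#; 2#)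
open ≡ using (refl; sym; trans; cong; cong₂; module ≡-Reasoning)

private variable
  f g f′ g′ : FPS

neg : FPS → FPS
neg f k = ℚ.- f k

-- Induction on the coefficient works, here and below, because `(f * g) (suc k)` unfolds to
-- `f 0 ℚ.* g (suc k)` plus `(f /t * g) k`.
*-congᶠ : f ≈ f′ → g ≈ g′ → f * g ≈ f′ * g′
*-congᶠ p q zero    = cong (ℚ._+ 0ℚ) (cong₂ ℚ._*_ (p 0) (q 0))
*-congᶠ p q (suc k) = cong₂ ℚ._+_ (cong₂ ℚ._*_ (p 0) (q (suc k))) (*-congᶠ (λ j → p (suc j)) q k)

-- The mirror image of the defining unfolding, with the tail taken in the second factor;
-- commutativity follows by comparing the two.
*-tailʳ : ∀ f g k → (f * g) (suc k) ≡ f (suc k) ℚ.* g 0 ℚ.+ (f * g /t) k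
*-tailʳ f g zero    =
  solve 4 (λ a b c d → a :* d :+ (b :* c :+ con 0ℚ) := b :* c :+ (a :* d :+ con 0ℚ)) refl (f 0) (f 1) (g 0) (g 1)
  where open ℚ-Solver
*-tailʳ f g (suc k) = begin
  f 0 ℚ.* g (suc (suc k)) ℚ.+ (f /t * g) (suc k)
    ≡⟨ cong (f 0 ℚ.* g (suc (suc k)) ℚ.+_) (*-tailʳ (f /t) g k) ⟩
  f 0 ℚ.* g (suc (suc k)) ℚ.+ (f (suc (suc k)) ℚ.* g 0 ℚ.+ (f /t * g /t) k)
    ≡⟨ solve 3 (λ x y z → x :+ (y :+ z) := y :+ (x :+ z)) refl
         (f 0 ℚ.* g (suc (suc k))) (f (suc (suc k)) ℚ.* g 0) ((f /t * g /t) k) ⟩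
  f (suc (suc k)) ℚ.* g 0 ℚ.+ (f * g /t) (suc k) ∎
  where
  open ≡-Reasoning
  open ℚ-Solver

*-commᶠ : ∀ f g → f * g ≈ g * f
*-commᶠ f g zero    = cong (ℚ._+ 0ℚ) (ℚ.*-comm (f 0) (g 0))
*-commᶠ f g (suc k) = trans
  (cong₂ ℚ._+_ (ℚ.*-comm (f 0) (g (suc k))) (*-commᶠ (f /t) g k))
  (sym (*-tailʳ g f k))

*-distribʳᶠ : ∀ h f g → (f + g) * h ≈ f * h + g * h
*-distribʳᶠ h f g zero    =
  solve 3 (λ a b c → (a :+ b) :* c :+ con 0ℚ := (a :* c :+ con 0ℚ) :+ (b :* c :+ con 0ℚ)) refl (f 0) (g 0) (h 0)
  where open ℚ-Solver
*-distribʳᶠ h f g (suc k) = trans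
  (cong ((f 0 ℚ.+ g 0) ℚ.* h (suc k) ℚ.+_) (*-distribʳᶠ h (f /t) (g /t) k))
  (solve 5 (λ a b c x y → (a :+ b) :* c :+ (x :+ y) := (a :* c :+ x) :+ (b :* c :+ y)) refl
    (f 0) (g 0) (h (suc k)) ((f /t * h) k) ((g /t * h) k))
  where open ℚ-Solver

*-distribˡᶠ : ∀ h f g → h * (f + g) ≈ h * f + h * g
*-distribˡᶠ h f g k = trans (*-commᶠ h (f + g) k)
  (trans (*-distribʳᶠ h f g k) (cong₂ ℚ._+_ (*-commᶠ f h k) (*-commᶠ g h k)))

*-scale : ∀ c f g k → ((λ j → c ℚ.* f j) * g) k ≡ c ℚ.* (f * g) k
*-scale c f g zero    =
  solve 3 (λ c x y → (c :* x) :* y :+ con 0ℚ := c :* (x :* y :+ con 0ℚ)) refl c (f 0) (g 0)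
  where open ℚ-Solver
*-scale c f g (suc k) = trans
  (cong (c ℚ.* f 0 ℚ.* g (suc k) ℚ.+_) (*-scale c (f /t) g k))
  (solve 4 (λ c x y z → c :* x :* y :+ c :* z := c :* (x :* y :+ z)) refl c (f 0) (g (suc k)) ((f /t * g) k))
  where open ℚ-Solver

*-assocᶠ : ∀ f g h → (f * g) * h ≈ f * (g * h)
*-assocᶠ f g h zero    =
  solve 3 (λ x y z → (x :* y :+ con 0ℚ) :* z :+ con 0ℚ := x :* (y :* z :+ con 0ℚ) :+ con 0ℚ) refl (f 0) (g 0) (h 0)
  where open ℚ-Solver
*-assocᶠ f g h (suc k) = begin
  (f 0 ℚ.* g 0 ℚ.+ 0ℚ) ℚ.* h (suc k) ℚ.+ (((λ j → f 0 ℚ.* g (suc j)) + f /t * g) * h) k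
    ≡⟨ cong ((f 0 ℚ.* g 0 ℚ.+ 0ℚ) ℚ.* h (suc k) ℚ.+_) (trans (*-distribʳᶠ h (λ j → f 0 ℚ.* g (suc j)) (f /t * g) k)
         (cong₂ ℚ._+_ (*-scale (f 0) (g /t) h k) (*-assocᶠ (f /t) g h k))) ⟩
  (f 0 ℚ.* g 0 ℚ.+ 0ℚ) ℚ.* h (suc k) ℚ.+ (f 0 ℚ.* (g /t * h) k ℚ.+ (f /t * (g * h)) k)
    ≡⟨ solve 5 (λ a b c x y → (a :* b :+ con 0ℚ) :* c :+ (a :* x :+ y) := a :* (b :* c :+ x) :+ y) refl
         (f 0) (g 0) (h (suc k)) ((g /t * h) k) ((f /t * (g * h)) k) ⟩
  f 0 ℚ.* (g 0 ℚ.* h (suc k) ℚ.+ (g /t * h) k) ℚ.+ (f /t * (g * h)) k ∎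
  where
  open ≡-Reasoning
  open ℚ-Solver

const-* : ∀ c g k → (const c * g) k ≡ c ℚ.* g k
const-* c g zero    = ℚ.+-identityʳ _
const-* c g (suc k) = trans (cong (c ℚ.* g (suc k) ℚ.+_) zeros) (ℚ.+-identityʳ _)
  where
  zeros : ((λ _ → 0ℚ) * g) k ≡ 0ℚ
  zeros = trans (*-scale 0ℚ (λ _ → 0ℚ) g k) (ℚ.*-zeroˡ (((λ _ → 0ℚ) * g) k))

≈-isEquivalence : IsEquivalence _≈_
≈-isEquivalence = record
  { refl  = λ _ → refl
  ; sym   = λ p k → sym (p k)
  ; trans = λ p q k → trans (p k) (q k)
  }

0#≡0 : ∀ k → 0# k ≡ 0ℚ
0#≡0 zero    = refl
0#≡0 (suc k) = refl

FPS-commutativeRing : CommutativeRing 0ℓ 0ℓ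
FPS-commutativeRing = record
  { Carrier = FPS
  ; _≈_ = _≈_
  ; _+_ = _+_
  ; _*_ = _*_
  ; -_  = neg
  ; 0#  = 0#
  ; 1#  = 1#
  ; isCommutativeRing = record
    { isRing = record
      { +-isAbelianGroup = record
        { isGroup = record
          { isMonoid = record
            { isSemigroup = record
              { isMagma = record
                { isEquivalence = ≈-isEquivalence
                ; ∙-cong = λ p q k → cong₂ ℚ._+_ (p k) (q k)
                }
              ; assoc = λ f g h k → ℚ.+-assoc (f k) (g k) (h k)
              }
            ; identity = (λ f k → trans (cong (ℚ._+ f k) (0#≡0 k)) (ℚ.+-identityˡ (f k)))
                       , (λ f k → trans (cong (f k ℚ.+_) (0#≡0 k)) (ℚ.+-identityʳ (f k)))
            }
          ; inverse = (λ f k → trans (ℚ.+-inverseˡ (f k)) (sym (0#≡0 k)))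
                    , (λ f k → trans (ℚ.+-inverseʳ (f k)) (sym (0#≡0 k)))
          ; ⁻¹-cong = λ p k → cong ℚ.-_ (p k)
          }
        ; comm = λ f g k → ℚ.+-comm (f k) (g k)
        }
      ; *-cong = *-congᶠ
      ; *-assoc = *-assocᶠ
      ; *-identity = 1-*ᶠ , λ f k → trans (*-commᶠ f 1# k) (1-*ᶠ f k)
      ; distrib = *-distribˡᶠ , *-distribʳᶠ
      }
    ; *-comm = *-commᶠ
    }
  }
  where
  1-*ᶠ : ∀ f → 1# * f ≈ f
  1-*ᶠ f k = trans (const-* 1ℚ f k) (ℚ.*-identityˡ (f k))

const-morphism : ℚ.+-*-rawRing -Raw-AlmostCommutative⟶ fromCommutativeRing FPS-commutativeRing
const-morphism = record
  { ⟦_⟧    = const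
  ; +-homo = λ { a b zero → refl ; a b (suc k) → refl }
  ; *-homo = λ { a b zero → sym (const-* a (const b) 0)
               ; a b (suc k) → sym (trans (const-* a (const b) (suc k)) (ℚ.*-zeroʳ a)) }
  ; -‿homo = λ { a zero → refl ; a (suc k) → refl }
  ; 0-homo = λ _ → refl
  ; 1-homo = λ _ → refl
  }

open Algebraic FPS-commutativeRing const-morphism
  using (Derivation; module Derivation; scale; sδv≈v; t[1+v²]≈2v; /-unique; /-cancel)

-- The derivation t·d/dt on power series.

exponent : ℕ → ℚ
exponent zero    = 0ℚ
exponent (suc k) = 1ℚ ℚ.+ exponent k

θ : FPS → FPS
θ f k = exponent k ℚ.* f k

-- By induction through tails: `exponent (suc k)` unfolds to one more than `exponent k`, so the tail
-- of `θ f` is `f /t + θ (f /t)`.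
θ-* : ∀ f g → θ (f * g) ≈ θ f * g + f * θ g
θ-* f g zero    =
  solve 2 (λ x y → con 0ℚ :* (x :* y :+ con 0ℚ) := (con 0ℚ :* x :* y :+ con 0ℚ) :+ (x :* (con 0ℚ :* y) :+ con 0ℚ)) refl (f 0) (g 0)
  where open ℚ-Solver
θ-* f g (suc k) = begin
  (1ℚ ℚ.+ q) ℚ.* (f 0 ℚ.* g (suc k) ℚ.+ (f /t * g) k)
    ≡⟨ solve 4 (λ q x y u → (con 1ℚ :+ q) :* (x :* y :+ u) := x :* ((con 1ℚ :+ q) :* y) :+ u :+ q :* u) refl
         q (f 0) (g (suc k)) ((f /t * g) k) ⟩
  f 0 ℚ.* ((1ℚ ℚ.+ q) ℚ.* g (suc k)) ℚ.+ (f /t * g) k ℚ.+ q ℚ.* (f /t * g) k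
    ≡⟨ cong (f 0 ℚ.* ((1ℚ ℚ.+ q) ℚ.* g (suc k)) ℚ.+ (f /t * g) k ℚ.+_) (θ-* (f /t) g k) ⟩
  f 0 ℚ.* ((1ℚ ℚ.+ q) ℚ.* g (suc k)) ℚ.+ (f /t * g) k ℚ.+ ((θ (f /t) * g) k ℚ.+ (f /t * θ g) k)
    ≡⟨ solve 6 (λ x y z u v w → x :* y :+ u :+ (v :+ w) := (con 0ℚ :* x :* z :+ (u :+ v)) :+ (x :* y :+ w)) refl
         (f 0) ((1ℚ ℚ.+ q) ℚ.* g (suc k)) (g (suc k)) ((f /t * g) k) ((θ (f /t) * g) k) ((f /t * θ g) k) ⟩
  (0ℚ ℚ.* f 0 ℚ.* g (suc k) ℚ.+ ((f /t * g) k ℚ.+ (θ (f /t) * g) k)) ℚ.+ (f * θ g) (suc k)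
    ≡⟨ cong (λ u → 0ℚ ℚ.* f 0 ℚ.* g (suc k) ℚ.+ u ℚ.+ (f * θ g) (suc k)) θ-tail ⟩
  (θ f * g) (suc k) ℚ.+ (f * θ g) (suc k) ∎
  where
  open ≡-Reasoning
  open ℚ-Solver
  q = exponent k
  θ-tail : (f /t * g) k ℚ.+ (θ (f /t) * g) k ≡ ((θ f /t) * g) k
  θ-tail = trans (sym (*-distribʳᶠ g (f /t) (θ (f /t)) k))
    (*-congᶠ {g = g} (λ j → solve 2 (λ q x → x :+ q :* x := (con 1ℚ :+ q) :* x) refl (exponent j) (f (suc j))) (λ _ → refl) k)

θ-derivation : Derivation
θ-derivation = record
  { δ      = θ
  ; δ-cong = λ f≈g k → cong (exponent k ℚ.*_) (f≈g k)
  ; δ-+    = λ f g k → ℚ.*-distribˡ-+ (exponent k) (f k) (g k)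
  ; δ-*    = θ-*
  ; δ-⟦⟧   = λ { c zero → ℚ.*-zeroˡ c ; c (suc k) → ℚ.*-zeroʳ (exponent (suc k)) }
  }

θt≈t : θ t ≈ t
θt≈t zero          = refl
θt≈t (suc zero)    = refl
θt≈t (suc (suc k)) = ℚ.*-zeroʳ (exponent (suc (suc k)))

t-cancel : ∀ f g → t * f ≈ t * g → f ≈ g
t-cancel f g tf≈tg k = trans (sym (coefficient f)) (trans (tf≈tg (suc k)) (coefficient g))
  where
  coefficient : ∀ f → (t * f) (suc k) ≡ f k
  -- The series is `f` shifted up by one place: its `/t` is `f` again, and the prepended 0 is the
  -- constant term that `t*[f/t]` asks for.
  coefficient f = t*[f/t] (λ { zero → 0ℚ ; (suc j) → f j }) refl (suc k)

tv≈1-s : t * v ≈ 1# - √ (1# - t ^ 2)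
tv≈1-s = t*[f/t] (1# - √ (1# - t ^ 2)) refl

s²≈1-t² : √ (1# - t ^ 2) * √ (1# - t ^ 2) ≈ 1# - t ^ 2
s²≈1-t² = √-square (1# - t ^ 2) refl

theorem4p13 : (n : ℕ) → n ≥ 1 →
    (A n t ≈ (1# + t ^ 2) ^ n / (2# * (1# + t) ^ (n ∸ 1)) [ 2[1+t]^-invertible (n ∸ 1) ]
    * Pᵘᵈʳ n (2# * t / (1# + t ^ 2) [ [1+t²]-invertible ]))
    × (Pᵘᵈʳ n t ≈ 2# * (1# + v) ^ (n ∸ 1) / (1# + v ^ 2) ^ n [ [1+v²]^-invertible n ] * A n v)
theorem4p13 (suc m) (s≤s _) =
    /-unique (A n t) (Pᵘᵈʳ n z) d₁ ((1# + t ^ 2) ^ n)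
      (recip d₁ (2[1+t]^-invertible m)) (*-recip d₁ (2[1+t]^-invertible m))
      (Derivation.A≈P θ-derivation t z θt≈t z[1+t²]≈2t m)
  , /-unique (Pᵘᵈʳ n t) (A n v) d₂ (2# * (1# + v) ^ m)
      (recip d₂ ([1+v²]^-invertible n)) (*-recip d₂ ([1+v²]^-invertible n))
      (λ k → sym (Derivation.A≈P (scale s θ-derivation) v t
        (sδv≈v t v s tv≈1-s s²≈1-t² t-cancel θ-derivation θt≈t)
        (t[1+v²]≈2v t v s tv≈1-s s²≈1-t² t-cancel) m k))
  where
  n = suc m
  d₁ = 2# * (1# + t) ^ m
  d₂ = (1# + v ^ 2) ^ n
  s = √ (1# - t ^ 2)
  z = 2# * t / (1# + t ^ 2) [ [1+t²]-invertible ]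
  z[1+t²]≈2t : z * (1# + t ^ 2) ≈ 2# * t
  z[1+t²]≈2t = /-cancel (1# + t ^ 2) (2# * t)
    (recip (1# + t ^ 2) [1+t²]-invertible) (*-recip (1# + t ^ 2) [1+t²]-invertible)
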